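{- Let $q$ be a prime power and let $k,d \in \mathbb{N}$. Let $M = (q-1)\sum_{r=0}^{d} q^{kr} = (q-1)(q^{kd+k}-1)/(q^k-1)$, and suppose that $M$ has a divisor $c \in \mathbb{N}$ such that $c < (q-1)\frac{q^k - q^{ -kd}}{q^k-1}$. Then $h_q(M/c) \geq kd + k - c(q^k-1)/(q-1)$.
   Context: For a prime power $q$ and $n \in \mathbb{N}$, let $\sigma:\mathbb{F}_q^n\to\mathbb{F}_q^n$ be the cyclic shift $\sigma(\sum_{i=1}^n x_i e_i)=\sum_{i=1}^n x_{i-1}e_i$ (indices mod $n$), where $e_1,\dots,e_n$ is the standard basis. A subspace $U\le \mathbb{F}_q^n$ is cyclically covering if $\bigcup_{r=0}^{n-1}\sigma^r(U)=\mathbb{F}_q^n$. $h_q(n)$ denotes the maximum possible codimension of a cyclically covering subspace of $\mathbb{F}_q^n$. -}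

module Defs where

open import Level using (0ℓ)
open import Algebra.Bundles using (CommutativeRing)
open import Data.Nat using (ℕ; zero; suc; _∸_; _^_; _≤_)
open import Data.Nat as ℕ using ()
open import Data.Nat.Primality using (Prime)
open import Data.Fin using (Fin; zero; suc; fromℕ; inject₁)
open import Data.Product using (Σ; ∃; _×_; _,_)
open import Relation.Binary.PropositionalEquality using (_≡_)
open import Relation.Nullary using (¬_)

IsPrimePower : ℕ → Set
IsPrimePower q = Σ ℕ λ p → Σ ℕ λ e → Prime p × 1 ≤ e × q ≡ p ^ e

powSum : ℕ → ℕ → ℕ → ℕ
powSum q k zero    = 1
powSum q k (suc d) = powSum q k d ℕ.+ q ^ (k ℕ.* suc d)

M : ℕ → ℕ → ℕ → ℕ
M q k d = (q ∸ 1) ℕ.* powSum q k d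

-- geom q k = Σ_{i=0}^{k-1} q^i  ( = (q^k - 1)/(q - 1) )
geom : ℕ → ℕ → ℕ
geom q zero    = 0
geom q (suc k) = geom q k ℕ.+ q ^ k

record FiniteField (q : ℕ) : Set₁ where
  field
    commRing : CommutativeRing 0ℓ 0ℓ
  open CommutativeRing commRing public
  field
    0≉1     : ¬ (0# ≈ 1#)
    inverse : ∀ x → ¬ (x ≈ 0#) → ∃ λ y → (x * y) ≈ 1#
    enum    : Fin q → Carrier
    enum-surj : ∀ x → ∃ λ i → enum i ≈ x
    enum-inj  : ∀ i j → enum i ≈ enum j → i ≡ j

module LinAlg {q : ℕ} (F : FiniteField q) where
  open FiniteField F using (Carrier; _≈_; _+_; _*_; 0#)

  Vect : ℕ → Set
  Vect n = Fin n → Carrier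

  _≋_ : ∀ {n} → Vect n → Vect n → Set
  x ≋ y = ∀ i → x i ≈ y i

  0ᵛ : ∀ {n} → Vect n
  0ᵛ _ = 0#

  _+ᵛ_ : ∀ {n} → Vect n → Vect n → Vect n
  (x +ᵛ y) i = x i + y i

  _·ᵛ_ : ∀ {n} → Carrier → Vect n → Vect n
  (a ·ᵛ x) i = a * x i

  record IsSubspace {n : ℕ} (U : Vect n → Set) : Set where
    field
      resp  : ∀ {x y} → x ≋ y → U x → U y
      has0  : U 0ᵛ
      close+ : ∀ {x y} → U x → U y → U (x +ᵛ y)
      close· : ∀ a {x} → U x → U (a ·ᵛ x)

  lincomb : ∀ {s n} → (Fin s → Carrier) → (Fin s → Vect n) → Vect n
  lincomb {zero}  a b = 0ᵛ
  lincomb {suc s} a b = (a zero ·ᵛ b zero) +ᵛ lincomb (λ i → a (suc i)) (λ i → b (suc i))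

  LinIndep : ∀ {s n} → (Fin s → Vect n) → Set
  LinIndep b = ∀ a → lincomb a b ≋ 0ᵛ → ∀ i → a i ≈ 0#

  Spans : ∀ {s n} → (Vect n → Set) → (Fin s → Vect n) → Set
  Spans U b = (∀ i → U (b i)) × (∀ x → U x → ∃ λ a → lincomb a b ≋ x)

  HasDim : ∀ {n} → (Vect n → Set) → ℕ → Set
  HasDim {n} U r = Σ (Fin r → Vect n) λ b → LinIndep b × Spans U b

  prevIdx : ∀ {n} → Fin n → Fin n
  prevIdx {suc m} zero    = fromℕ m
  prevIdx {suc m} (suc i) = inject₁ i

  σ : ∀ {n} → Vect n → Vect n
  σ x i = x (prevIdx i)

  σ^ : ∀ {n} → ℕ → Vect n → Vect n
  σ^ zero    x = x
  σ^ (suc r) x = σ (σ^ r x)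

  CyclicallyCovering : ∀ {n} → (Vect n → Set) → Set
  CyclicallyCovering {n} U =
    ∀ x → Σ (Fin n) λ r → Σ (Vect n) λ u → U u × σ^ (Data.Fin.toℕ r) u ≋ x

  hAtLeast : ℕ → ℕ → Set₁
  hAtLeast n D = Σ (Vect n → Set) λ U → IsSubspace U × CyclicallyCovering U ×
                   Σ ℕ λ r → HasDim U r × D ≤ n ∸ r

{-# OPTIONS --safe #-}
module Submission where

-- Let N = kd + k, Q = q^N and C = c (q^k - 1)/(q - 1), so that nC = Q - 1. Let A = F[X]/(X^n - 1), realised as F^n
-- with X acting as σ. Since n ∣ Q - 1, Frobenius shows that a^Q = a for all a in A, so every element generates the same
-- ideal as an idempotent power of it. The product of the X^(n/ℓ) - 1 over the primes ℓ ∣ n is nonzero; choosing a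
-- minimal nonzero idempotent f in its ideal makes fA a field with at most Q elements in which X has order exactly n.
-- Hence X permutes the nonzero elements of fA freely, with m ≤ C orbits. Let W be spanned by orbit representatives; then
-- U = W + (1 - f)A is cyclically covering. Finally dim U ≤ n - N + C, because |U| |fA| ≤ q^m q^n, |fA| ≥ nm + 1,
-- and Q = nC + 1 ≤ (nm + 1) q^(C - m).

open import Level using (0ℓ)
open import Algebra.Bundles using (CommutativeRing)
import Algebra.Properties.CommutativeSemiring.Exp as CommutativeExp
import Algebra.Properties.Semiring.Exp as Exp
import Algebra.Properties.Semiring.Mult as Mult
open import Data.Empty using (⊥-elim)
open import Data.Fin.Base using (Fin; zero; suc; toℕ; fromℕ; fromℕ<; inject₁; punchIn; finToFun; funToFin; combine; remQuot)
open import Data.Fin.Permutation using (Permutation; permutation; _⟨$⟩ʳ_)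
open import Data.Fin.Properties as Fin using (toℕ<n)
open import Data.List.Base using (List; []; _∷_; _++_; map; tabulate; length; lookup; applyUpTo)
open import Data.List.Membership.Propositional using (_∈_; find)
open import Data.List.Membership.Propositional.Properties using (∈-lookup)
open import Data.List.Properties using (length-++; length-applyUpTo)
open import Data.List.Relation.Unary.All as All using (All; []; _∷_)
import Data.List.Relation.Unary.All.Properties as All
open import Data.List.Relation.Unary.AllPairs using (AllPairs; []; _∷_)
import Data.List.Relation.Unary.AllPairs.Properties as AllPairs
open import Data.List.Relation.Unary.Any as Any using (Any; here; there)
import Data.List.Relation.Unary.Any.Properties as Any
open import Data.Nat.Base as ℕ using (ℕ; zero; suc; _!; z≤n; s≤s; NonZero)
open import Data.Nat.Combinatorics using (nCn≡1; k![n∸k]!∣n!; nCk≡n!/k![n-k]!) renaming (_C_ to _choose_)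
open import Data.Nat.Divisibility
open import Data.Nat.DivMod using (m/n*n≡m; m<n⇒m%n≡m; [m+kn]%n≡m%n)
open import Data.Nat.GCD using (gcd; gcd-GCD; gcd[m,n]∣m; gcd[m,n]∣n; module Bézout)
open import Data.Nat.ListAction using (product)
open import Data.Nat.Primality using (Prime; prime?; euclidsLemma; prime⇒nonTrivial; prime⇒nonZero)
open import Data.Nat.Primality.Factorisation using (factorise)
import Data.Nat.Properties as ℕ
open import Data.Nat.Properties using (_!*_!≢0)
open import Data.Nat.Solver using (module +-*-Solver)
open import Data.Product using (Σ; ∃; ∃₂; _×_; _,_; proj₁; proj₂)
open import Data.Sum using (_⊎_; inj₁; inj₂)
open import Data.Vec.Base using (Vec; []; _∷_; replicate)
import Data.Vec.Functional as Vector
open import Function.Base using (_∘_)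
open import Relation.Binary.PropositionalEquality as ≡ using (_≡_; _≢_)
open import Relation.Nullary using (¬_; Dec; yes; no; contradiction; _×-dec_)

open import Defs

-- No field with Q elements and no irreducible factor of X^n - 1 is ever constructed. The identity
-- a^Q = a stands in for semisimplicity: it turns every principal ideal into one generated by an
-- idempotent, and a minimal idempotent is then found by running through the finitely many elements
-- of A. X has order exactly n on fA for the following reason. If X^r with 0 < r < n fixes y in fA,
-- then so does X^gcd(r,n), hence also X^(n/ℓ) for some prime ℓ dividing n; the corresponding factor
-- X^(n/ℓ) - 1 of the product kills y, and so does f, whence y = 0. The bound on fA holds because
-- its nonzero elements are roots of Y^(Q-1) - 1. fA may be smaller than Q, but this does no harm:
-- each orbit missing from C takes one vector off the spanning set of W, and that gains a factor q,
-- whereas Q exceeds |fA| by a factor of at most 1 + (C - m). The orbit representatives may be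
-- linearly dependent, so m only bounds dim W from above. Counting pairs in U × fA accommodates this
-- and avoids computing dim fA.

-- Binomial coefficients modulo a prime and the Frobenius map.

prime∤1 : ∀ {p} → Prime p → ¬ (p ∣ 1)
prime∤1 {p} p-prime p∣1 = ℕ.<⇒≱ (ℕ.nonTrivial⇒n>1 p {{prime⇒nonTrivial p-prime}}) (∣⇒≤ p∣1)

prime∤k! : ∀ {p} → Prime p → ∀ k → k ℕ.< p → ¬ (p ∣ k !)
prime∤k! pp zero k<p p∣1 = prime∤1 pp p∣1
prime∤k! pp (suc k) k<p p∣ with euclidsLemma (suc k) (k !) pp p∣
... | inj₁ p∣sk = ℕ.<⇒≱ k<p (∣⇒≤ p∣sk)
... | inj₂ p∣k! = prime∤k! pp k (ℕ.<-trans (ℕ.n<1+n k) k<p) p∣k!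

-- p divides p! = (p choose k) k! (p - k)!, but neither of the two factorials on the right, whose
-- arguments are smaller than p.
prime∣pCk : ∀ {p} → Prime p → ∀ k → 0 ℕ.< k → k ℕ.< p → p ∣ p choose k
prime∣pCk {zero}  pp k 0<k ()
prime∣pCk {suc p-1} pp k 0<k k<p = result
  where
  p = suc p-1
  k≤p = ℕ.<⇒≤ k<p
  instance _ = k !* (p ℕ.∸ k) !≢0
  product≡p! : (p choose k) ℕ.* (k ! ℕ.* (p ℕ.∸ k) !) ≡ p !
  product≡p! = ≡.trans (≡.cong (ℕ._* (k ! ℕ.* (p ℕ.∸ k) !)) (nCk≡n!/k![n-k]! k≤p))
                       (m/n*n≡m (k![n∸k]!∣n! k≤p))
  result : p ∣ p choose k
  result with euclidsLemma (p choose k) (k ! ℕ.* (p ℕ.∸ k) !) pp (≡.subst (p ∣_) (≡.sym product≡p!) (m∣m*n (p-1 !)))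
  ... | inj₁ h = h
  ... | inj₂ h with euclidsLemma (k !) ((p ℕ.∸ k) !) pp h
  ...   | inj₁ h′ = contradiction h′ (prime∤k! pp k k<p)
  ...   | inj₂ h′ = contradiction h′ (prime∤k! pp (p ℕ.∸ k) (ℕ.∸-monoʳ-< 0<k k≤p))

module Frobenius (R : CommutativeRing 0ℓ 0ℓ) where
  open CommutativeRing R hiding (zero)
  open import Algebra.Properties.CommutativeSemiring.Binomial commutativeSemiring
    using (theorem; binomialTerm)
  open import Algebra.Properties.CommutativeSemiring.Exp commutativeSemiring
  open import Algebra.Properties.Semiring.Mult semiring renaming (_×_ to _×ₙ_)
  open import Algebra.Properties.Semiring.Sum semiring
  open import Relation.Binary.Reasoning.Setoid setoid

  ×-annihilates : ∀ p → p ×ₙ 1# ≈ 0# → ∀ m → p ∣ m → ∀ x → m ×ₙ x ≈ 0#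
  ×-annihilates p p≈0 m (divides j ≡.refl) x = begin
    (j ℕ.* p) ×ₙ x            ≈⟨ ×-assocˡ x j p ⟨
    j ×ₙ (p ×ₙ x)             ≈⟨ ×-congʳ j (×-congʳ p (*-identityˡ x)) ⟨
    j ×ₙ (p ×ₙ (1# * x))      ≈⟨ ×-congʳ j (×-assoc-* p 1# x) ⟨
    j ×ₙ ((p ×ₙ 1#) * x)      ≈⟨ ×-congʳ j (*-congʳ p≈0) ⟩
    j ×ₙ (0# * x)             ≈⟨ ×-congʳ j (zeroˡ x) ⟩
    j ×ₙ 0#                   ≈⟨ sum-replicate j ⟨
    sum {j} (λ _ → 0#)        ≈⟨ sum-replicate-zero j ⟩
    0#                        ∎

  -- In the binomial expansion only the two extreme terms survive, the other coefficients being
  -- multiples of p.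
  frobenius-+ : ∀ {p} → Prime p → p ×ₙ 1# ≈ 0# → ∀ x y → (x + y) ^ p ≈ x ^ p + y ^ p
  frobenius-+ {zero} pp p≈0 x y = ⊥-elim (ℕ.≢-nonZero⁻¹ 0 {{prime⇒nonZero pp}} ≡.refl)
  frobenius-+ {suc m} pp p≈0 x y = begin
    (x + y) ^ p                                         ≈⟨ theorem p x y ⟩
    term zero + sum (λ i → term (suc i))                ≈⟨ +-cong first≈ (sum-init-last (λ i → term (suc i))) ⟩
    y ^ p + (sum (λ i → term (suc (inject₁ i))) + term (fromℕ p))
                                                        ≈⟨ +-congˡ (+-cong middle≈ last≈) ⟩
    y ^ p + (0# + x ^ p)                                ≈⟨ +-congˡ (+-identityˡ _) ⟩
    y ^ p + x ^ p                                       ≈⟨ +-comm _ _ ⟩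
    x ^ p + y ^ p                                       ∎
    where
    p = suc m
    term = binomialTerm x y p
    first≈ : term zero ≈ y ^ p
    first≈ = trans (×-homo-1 _) (*-identityˡ _)
    last≈ : term (fromℕ p) ≈ x ^ p
    last≈ = begin
      (p choose toℕ (fromℕ p)) ×ₙ (x ^ toℕ (fromℕ p) * y ^ (p ℕ.∸ toℕ (fromℕ p)))
        ≡⟨ ≡.cong (λ k → (p choose k) ×ₙ (x ^ k * y ^ (p ℕ.∸ k))) (Fin.toℕ-fromℕ p) ⟩
      (p choose p) ×ₙ (x ^ p * y ^ (p ℕ.∸ p))
        ≡⟨ ≡.cong₂ (λ a b → a ×ₙ (x ^ p * y ^ b)) (nCn≡1 p) (ℕ.n∸n≡0 p) ⟩
      1 ×ₙ (x ^ p * 1#) ≈⟨ ×-homo-1 _ ⟩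
      x ^ p * 1#        ≈⟨ *-identityʳ _ ⟩
      x ^ p             ∎
    middle≈ : sum (λ i → term (suc (inject₁ i))) ≈ 0#
    middle≈ = trans (sum-cong-≋ {m} (λ i → ×-annihilates p p≈0 _
                      (prime∣pCk pp _ (s≤s z≤n) (s≤s (≡.subst (ℕ._< m) (≡.sym (Fin.toℕ-inject₁ i)) (toℕ<n i)))) _))
                    (sum-replicate-zero m)

  frobenius^-+ : ∀ {p} → Prime p → p ×ₙ 1# ≈ 0# → ∀ j x y →
                 (x + y) ^ (p ℕ.^ j) ≈ x ^ (p ℕ.^ j) + y ^ (p ℕ.^ j)
  frobenius^-+ pp p≈0 zero x y = trans (*-identityʳ _) (sym (+-cong (*-identityʳ _) (*-identityʳ _)))
  frobenius^-+ {p} pp p≈0 (suc j) x y = begin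
    (x + y) ^ (p ℕ.* p ℕ.^ j)                       ≈⟨ ^-assocʳ _ p (p ℕ.^ j) ⟨
    ((x + y) ^ p) ^ (p ℕ.^ j)                       ≈⟨ ^-congˡ (p ℕ.^ j) (frobenius-+ pp p≈0 x y) ⟩
    (x ^ p + y ^ p) ^ (p ℕ.^ j)                     ≈⟨ frobenius^-+ pp p≈0 j _ _ ⟩
    (x ^ p) ^ (p ℕ.^ j) + (y ^ p) ^ (p ℕ.^ j)       ≈⟨ +-cong (^-assocʳ x p (p ℕ.^ j)) (^-assocʳ y p (p ℕ.^ j)) ⟩
    x ^ (p ℕ.* p ℕ.^ j) + y ^ (p ℕ.* p ℕ.^ j)       ∎

-- Arithmetic of the finite field F.

module FieldProperties {q : ℕ} (F : FiniteField q) where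
  open FiniteField F hiding (zero)
  open import Algebra.Properties.CommutativeSemiring.Exp commutativeSemiring
  open import Algebra.Properties.Semiring.Mult semiring renaming (_×_ to _×ₙ_)
  open import Algebra.Properties.Semiring.Sum semiring
  import Algebra.Properties.CommutativeMonoid.Sum *-commutativeMonoid as Π
  open import Algebra.Properties.Ring ring using (+-cancelˡ; //-rightDividesˡ; //-rightDividesʳ)
  open import Relation.Binary.Reasoning.Setoid setoid

  index : Carrier → Fin q
  index x = proj₁ (enum-surj x)

  enum-index : ∀ x → enum (index x) ≈ x
  enum-index x = proj₂ (enum-surj x)

  index-cong : ∀ {x y} → x ≈ y → index x ≡ index y
  index-cong {x} {y} x≈y = enum-inj _ _ (trans (enum-index x) (trans x≈y (sym (enum-index y))))

  index-enum : ∀ i → index (enum i) ≡ i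
  index-enum i = enum-inj _ _ (enum-index (enum i))

  index-injective : ∀ {x y} → index x ≡ index y → x ≈ y
  index-injective {x} {y} eq = trans (sym (enum-index x)) (trans (reflexive (≡.cong enum eq)) (enum-index y))

  _≟_ : ∀ x y → Dec (x ≈ y)
  x ≟ y with index x Fin.≟ index y
  ... | yes eq = yes (index-injective eq)
  ... | no neq = no (neq ∘ index-cong)

  *-domain : ∀ x y → x * y ≈ 0# → x ≈ 0# ⊎ y ≈ 0#
  *-domain x y xy≈0 with x ≟ 0#
  ... | yes x≈0 = inj₁ x≈0
  ... | no x≉0 = let x⁻¹ , xx⁻¹≈1 = inverse x x≉0 in inj₂ (begin
    y               ≈⟨ *-identityˡ y ⟨
    1# * y          ≈⟨ *-congʳ xx⁻¹≈1 ⟨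
    x * x⁻¹ * y     ≈⟨ *-congʳ (*-comm x x⁻¹) ⟩
    x⁻¹ * x * y     ≈⟨ *-assoc _ _ _ ⟩
    x⁻¹ * (x * y)   ≈⟨ *-congˡ xy≈0 ⟩
    x⁻¹ * 0#        ≈⟨ zeroʳ _ ⟩
    0#              ∎)

  *-nonzero : ∀ {x y} → ¬ (x ≈ 0#) → ¬ (y ≈ 0#) → ¬ (x * y ≈ 0#)
  *-nonzero x≉0 y≉0 xy≈0 with *-domain _ _ xy≈0
  ... | inj₁ x≈0 = x≉0 x≈0
  ... | inj₂ y≈0 = y≉0 y≈0

  *-cancelʳ-nonzero : ∀ {x y z} → ¬ (z ≈ 0#) → x * z ≈ y * z → x ≈ y
  *-cancelʳ-nonzero {x} {y} {z} z≉0 xz≈yz = let z⁻¹ , zz⁻¹≈1 = inverse z z≉0 in begin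
    x               ≈⟨ *-identityʳ x ⟨
    x * 1#          ≈⟨ *-congˡ zz⁻¹≈1 ⟨
    x * (z * z⁻¹)   ≈⟨ *-assoc _ _ _ ⟨
    x * z * z⁻¹     ≈⟨ *-congʳ xz≈yz ⟩
    y * z * z⁻¹     ≈⟨ *-assoc _ _ _ ⟩
    y * (z * z⁻¹)   ≈⟨ *-congˡ zz⁻¹≈1 ⟩
    y * 1#          ≈⟨ *-identityʳ y ⟩
    y               ∎

  bijection : (f g : Carrier → Carrier) → (∀ {x y} → x ≈ y → f x ≈ f y) → (∀ {x y} → x ≈ y → g x ≈ g y) →
              (∀ x → f (g x) ≈ x) → (∀ x → g (f x) ≈ x) → Permutation q q
  bijection f g f-cong g-cong fg gf = permutation (λ i → index (f (enum i))) (λ i → index (g (enum i)))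
    (λ i → ≡.trans (index-cong (trans (f-cong (enum-index _)) (fg _))) (index-enum i))
    (λ i → ≡.trans (index-cong (trans (g-cong (enum-index _)) (gf _))) (index-enum i))

  -- Translation by 1 permutes F, so Σ x = Σ (x + 1) = Σ x + q · 1.
  q×1≈0 : q ×ₙ 1# ≈ 0#
  q×1≈0 = sym (+-cancelˡ (sum enum) 0# (q ×ₙ 1#) (begin
    sum enum + 0#                       ≈⟨ +-identityʳ _ ⟩
    sum enum                            ≈⟨ sum-permute enum π ⟩
    sum (λ i → enum (π ⟨$⟩ʳ i))         ≈⟨ sum-cong-≋ (λ i → enum-index (enum i + 1#)) ⟩
    sum (λ i → enum i + 1#)             ≈⟨ ∑-distrib-+ enum (λ _ → 1#) ⟩
    sum enum + sum {q} (λ _ → 1#)       ≈⟨ +-congˡ (sum-replicate q) ⟩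
    sum enum + q ×ₙ 1#                  ∎))
    where
    π : Permutation q q
    π = bijection (_+ 1#) (_- 1#) +-congʳ +-congʳ (//-rightDividesˡ 1#) (//-rightDividesʳ 1#)

  -- q·1 = (p·1)^e vanishes and F is a domain, so one of the factors p·1 vanishes.
  characteristic : ∀ {p} e → p ℕ.^ e ≡ q → p ×ₙ 1# ≈ 0#
  characteristic {p} e p^e≡q = descend e (trans (×-congˡ p^e≡q) q×1≈0)
    where
    descend : ∀ j → (p ℕ.^ j) ×ₙ 1# ≈ 0# → p ×ₙ 1# ≈ 0#
    descend zero    h = ⊥-elim (0≉1 (trans (sym h) (+-identityʳ 1#)))
    descend (suc j) h with *-domain (p ×ₙ 1#) ((p ℕ.^ j) ×ₙ 1#) (trans (sym (×1-homo-* p (p ℕ.^ j))) h)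
    ... | inj₁ p≈0 = p≈0
    ... | inj₂ h′  = descend j h′

  -- Lets the product of the nonzero elements be taken over the whole index set `Fin q`, with zero
  -- contributing the neutral factor 1.
  nonzeroOrOne : Carrier → Carrier
  nonzeroOrOne x with x ≟ 0#
  ... | yes _ = 1#
  ... | no  _ = x

  nonzeroOrOne-≉0 : ∀ x → ¬ (nonzeroOrOne x ≈ 0#)
  nonzeroOrOne-≉0 x with x ≟ 0#
  ... | yes _  = λ 1≈0 → 0≉1 (sym 1≈0)
  ... | no x≉0 = x≉0

  nonzeroOrOne-zero : ∀ {x} → x ≈ 0# → nonzeroOrOne x ≈ 1#
  nonzeroOrOne-zero {x} x≈0 with x ≟ 0#
  ... | yes _  = refl
  ... | no x≉0 = contradiction x≈0 x≉0

  nonzeroOrOne-nonzero : ∀ {x} → ¬ (x ≈ 0#) → nonzeroOrOne x ≈ x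
  nonzeroOrOne-nonzero {x} x≉0 with x ≟ 0#
  ... | yes x≈0 = contradiction x≈0 x≉0
  ... | no _    = refl

  nonzeroOrOne-cong : ∀ {x y} → x ≈ y → nonzeroOrOne x ≈ nonzeroOrOne y
  nonzeroOrOne-cong {x} {y} x≈y with x ≟ 0#
  ... | yes x≈0 = sym (nonzeroOrOne-zero (trans (sym x≈y) x≈0))
  ... | no x≉0  = trans x≈y (sym (nonzeroOrOne-nonzero (λ y≈0 → x≉0 (trans x≈y y≈0))))

  Π-≉0 : ∀ {m} (t : Fin m → Carrier) → (∀ i → ¬ (t i ≈ 0#)) → ¬ (Π.sum t ≈ 0#)
  Π-≉0 {zero}  t t≉0 1≈0 = 0≉1 (sym 1≈0)
  Π-≉0 {suc m} t t≉0 = *-nonzero (t≉0 zero) (Π-≉0 (t ∘ suc) (t≉0 ∘ suc))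

-- Multiplication by s permutes the nonzero elements, so their product is multiplied by s ^ (q - 1).
fermat : ∀ {q} (F : FiniteField q) s → FiniteField._≈_ F (Exp._^_ (FiniteField.semiring F) s q) s
fermat {zero} F s with FieldProperties.index F (FiniteField.0# F)
... | ()
fermat {suc q-1} F s = result
  where
  open FiniteField F hiding (zero)
  open FieldProperties F
  open import Algebra.Properties.CommutativeSemiring.Exp commutativeSemiring
  import Algebra.Properties.CommutativeMonoid.Sum *-commutativeMonoid as Π
  open import Relation.Binary.Reasoning.Setoid setoid

  nonzero-case : ¬ (s ≈ 0#) → s ^ q-1 ≈ 1#
  nonzero-case s≉0 = *-cancelʳ-nonzero (Π-≉0 _ (nonzeroOrOne-≉0 ∘ enum)) (begin
    s ^ q-1 * Π.sum h                             ≈⟨ *-congʳ Πt≈ ⟨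
    Π.sum t * Π.sum h                             ≈⟨ Π.∑-distrib-+ t h ⟨
    Π.sum (λ i → t i * h i)                       ≈⟨ Π.sum-cong-≋ pointwise ⟨
    Π.sum (λ i → h (π ⟨$⟩ʳ i))                    ≈⟨ Π.sum-permute h π ⟨
    Π.sum h                                       ≈⟨ *-identityˡ _ ⟨
    1# * Π.sum h                                  ∎)
    where
    s⁻¹ = proj₁ (inverse s s≉0)
    ss⁻¹≈1 = proj₂ (inverse s s≉0)
    π : Permutation (suc q-1) (suc q-1)
    π = bijection (s *_) (s⁻¹ *_) *-congˡ *-congˡ
          (λ x → trans (sym (*-assoc _ _ _)) (trans (*-congʳ ss⁻¹≈1) (*-identityˡ x)))
          (λ x → trans (sym (*-assoc _ _ _)) (trans (*-congʳ (trans (*-comm _ _) ss⁻¹≈1)) (*-identityˡ x)))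
    h : Fin (suc q-1) → Carrier
    h i = nonzeroOrOne (enum i)
    -- The factor by which x ↦ s x changes `nonzeroOrOne x`. It is 1 only at zero, so its product
    -- over F is s^(q-1).
    scale : Carrier → Carrier
    scale x with x ≟ 0#
    ... | yes _ = 1#
    ... | no  _ = s
    scale-zero : ∀ {x} → x ≈ 0# → scale x ≈ 1#
    scale-zero {x} x≈0 with x ≟ 0#
    ... | yes _  = refl
    ... | no x≉0 = contradiction x≈0 x≉0
    scale-nonzero : ∀ {x} → ¬ (x ≈ 0#) → scale x ≈ s
    scale-nonzero {x} x≉0 with x ≟ 0#
    ... | yes x≈0 = contradiction x≈0 x≉0
    ... | no _    = refl
    t : Fin (suc q-1) → Carrier
    t i = scale (enum i)
    i₀ = index 0#
    Πt≈ : Π.sum t ≈ s ^ q-1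
    Πt≈ = begin
      Π.sum t                                 ≈⟨ Π.sum-remove {i = i₀} t ⟩
      t i₀ * Π.sum (λ j → t (punchIn i₀ j))   ≈⟨ *-cong (scale-zero (enum-index 0#)) (Π.sum-cong-≋ {q-1} (λ j →
                                                   scale-nonzero (λ eq → Fin.punchInᵢ≢i i₀ j
                                                     (enum-inj _ _ (trans eq (sym (enum-index 0#))))))) ⟩
      1# * Π.sum {q-1} (λ _ → s)              ≈⟨ *-identityˡ _ ⟩
      Π.sum {q-1} (λ _ → s)                   ≈⟨ Π.sum-replicate q-1 ⟩
      s ^ q-1                                 ∎
    pointwise : ∀ i → h (π ⟨$⟩ʳ i) ≈ t i * h i
    pointwise i = trans (nonzeroOrOne-cong (enum-index (s * enum i))) (case (enum i ≟ 0#))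
      where
      case : Dec (enum i ≈ 0#) → nonzeroOrOne (s * enum i) ≈ t i * h i
      case (yes x≈0) = trans (nonzeroOrOne-zero (trans (*-congˡ x≈0) (zeroʳ s)))
        (sym (trans (*-cong (scale-zero x≈0) (nonzeroOrOne-zero x≈0)) (*-identityˡ _)))
      case (no x≉0) = trans (nonzeroOrOne-nonzero (*-nonzero s≉0 x≉0))
        (sym (*-cong (scale-nonzero x≉0) (nonzeroOrOne-nonzero x≉0)))

  result : s * s ^ q-1 ≈ s
  result with s ≟ 0#
  ... | yes s≈0 = trans (*-congʳ s≈0) (trans (zeroˡ _) (sym s≈0))
  ... | no s≉0  = trans (*-congˡ (nonzero-case s≉0)) (*-identityʳ s)

-- Linear algebra over F, with F^n enumerated by `Fin (q ^ n)`.

module LinearAlgebra {q : ℕ} (F : FiniteField q) where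
  open FiniteField F hiding (zero)
  open LinAlg F
  open FieldProperties F
  open import Algebra.Properties.Semiring.Sum semiring
  open import Algebra.Properties.Ring ring using (-1*x≈-x; -‿distribˡ-*; +-inverseˡ-unique; x∙y⁻¹≈ε⇒x≈y)

  ≋-refl : ∀ {n} {x : Vect n} → x ≋ x
  ≋-refl i = refl

  ≋-sym : ∀ {n} {x y : Vect n} → x ≋ y → y ≋ x
  ≋-sym p i = sym (p i)

  ≋-trans : ∀ {n} {x y z : Vect n} → x ≋ y → y ≋ z → x ≋ z
  ≋-trans p r i = trans (p i) (r i)

  lincomb-sum : ∀ {s n} (a : Fin s → Carrier) (b : Fin s → Vect n) i → lincomb a b i ≈ sum (λ j → a j * b j i)
  lincomb-sum {zero}  a b i = refl
  lincomb-sum {suc s} a b i = +-congˡ (lincomb-sum (a ∘ suc) (b ∘ suc) i)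

  lincomb-cong : ∀ {s n} {a a′ : Fin s → Carrier} {b b′ : Fin s → Vect n} →
                 (∀ j → a j ≈ a′ j) → (∀ j → b j ≋ b′ j) → lincomb a b ≋ lincomb a′ b′
  lincomb-cong {zero}  a≈ b≈ i = refl
  lincomb-cong {suc s} a≈ b≈ i = +-cong (*-cong (a≈ zero) (b≈ zero i)) (lincomb-cong (a≈ ∘ suc) (b≈ ∘ suc) i)

  record IsLinear {m n} (T : Vect m → Vect n) : Set where
    field
      cong  : ∀ {x y} → x ≋ y → T x ≋ T y
      +-hom : ∀ x y → T (x +ᵛ y) ≋ (T x +ᵛ T y)
      ·-hom : ∀ s x → T (s ·ᵛ x) ≋ (s ·ᵛ T x)

    0-hom : T 0ᵛ ≋ 0ᵛ
    0-hom = ≋-trans (cong (λ i → sym (zeroˡ 0#))) (≋-trans (·-hom 0# 0ᵛ) (λ i → zeroˡ _))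

    lincomb-hom : ∀ {s} (a : Fin s → Carrier) (b : Fin s → Vect m) → T (lincomb a b) ≋ lincomb a (T ∘ b)
    lincomb-hom {zero}  a b = 0-hom
    lincomb-hom {suc s} a b = ≋-trans (+-hom _ _) (λ i → +-cong (·-hom _ _ i) (lincomb-hom (a ∘ suc) (b ∘ suc) i))

  lincomb-linearˡ : ∀ {s n} (b : Fin s → Vect n) → IsLinear (λ a → lincomb a b)
  lincomb-linearˡ {s} b = record
    { cong  = λ a≈ → lincomb-cong a≈ (λ j → ≋-refl)
    ; +-hom = λ a a′ i → trans (lincomb-sum _ b i) (trans
        (sum-cong-≋ {s} (λ j → distribʳ _ _ _)) (trans
        (∑-distrib-+ {s} _ _) (sym (+-cong (lincomb-sum a b i) (lincomb-sum a′ b i)))))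
    ; ·-hom = λ c a i → trans (lincomb-sum _ b i) (trans
        (sum-cong-≋ {s} (λ j → *-assoc _ _ _)) (trans
        (sym (*-distribˡ-sum {s} c _)) (*-congˡ (sym (lincomb-sum a b i)))))
    }

  lincomb-linearʳ : ∀ {s m n} (a : Fin s → Carrier) (T : Fin s → Vect m → Vect n) → (∀ j → IsLinear (T j)) →
                    IsLinear (λ x → lincomb a (λ j → T j x))
  lincomb-linearʳ {s} a T T-linear = record
    { cong  = λ x≋y → lincomb-cong (λ j → refl) (λ j → IsLinear.cong (T-linear j) x≋y)
    ; +-hom = λ x y i → trans (lincomb-sum a _ i) (trans
        (sum-cong-≋ {s} (λ j → trans (*-congˡ (IsLinear.+-hom (T-linear j) x y i)) (distribˡ _ _ _))) (trans
        (∑-distrib-+ {s} _ _) (sym (+-cong (lincomb-sum a _ i) (lincomb-sum a _ i)))))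
    ; ·-hom = λ c x i → trans (lincomb-sum a _ i) (trans
        (sum-cong-≋ {s} (λ j → trans (*-congˡ (IsLinear.·-hom (T-linear j) c x i))
          (trans (sym (*-assoc _ _ _)) (trans (*-congʳ (*-comm _ _)) (*-assoc _ _ _))))) (trans
        (sym (*-distribˡ-sum {s} c _)) (*-congˡ (sym (lincomb-sum a _ i)))))
    }

  lincomb-closed : ∀ {n s} {U : Vect n → Set} → IsSubspace U → (a : Fin s → Carrier) {b : Fin s → Vect n} →
                   (∀ j → U (b j)) → U (lincomb a b)
  lincomb-closed {s = zero}  U-sub a b∈ = IsSubspace.has0 U-sub
  lincomb-closed {s = suc s} U-sub a b∈ =
    IsSubspace.close+ U-sub (IsSubspace.close· U-sub (a zero) (b∈ zero)) (lincomb-closed U-sub (a ∘ suc) (b∈ ∘ suc))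

  Span : ∀ {s n} → (Fin s → Vect n) → Vect n → Set
  Span b x = ∃ λ a → lincomb a b ≋ x

  Span-isSubspace : ∀ {s n} (b : Fin s → Vect n) → IsSubspace (Span b)
  Span-isSubspace b = record
    { resp   = λ x≋y (a , a≈) → a , ≋-trans a≈ x≋y
    ; has0   = (λ _ → 0#) , IsLinear.0-hom (lincomb-linearˡ b)
    ; close+ = λ (a , a≈) (a′ , a′≈) → (λ j → a j + a′ j) ,
                 ≋-trans (IsLinear.+-hom (lincomb-linearˡ b) a a′) (λ i → +-cong (a≈ i) (a′≈ i))
    ; close· = λ c (a , a≈) → (λ j → c * a j) ,
                 ≋-trans (IsLinear.·-hom (lincomb-linearˡ b) c a) (λ i → *-congˡ (a≈ i))
    }

  lincomb-zero-head : ∀ {s n} {a : Fin (suc s) → Carrier} (b : Fin (suc s) → Vect n) → a zero ≈ 0# →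
                      lincomb a b ≋ lincomb (a ∘ suc) (b ∘ suc)
  lincomb-zero-head b a₀≈0 i = trans (+-congʳ (trans (*-congʳ a₀≈0) (zeroˡ _))) (+-identityˡ _)

  Span-weaken : ∀ {s n} (b : Fin (suc s) → Vect n) {x} → Span (b ∘ suc) x → Span b x
  Span-weaken b (a , a≈) = 0# Vector.∷ a , ≋-trans (lincomb-zero-head {a = 0# Vector.∷ a} b refl) a≈

  Span-generator : ∀ {s n} (b : Fin s → Vect n) j → Span b (b j)
  Span-generator b zero = 1# Vector.∷ (λ _ → 0#) , λ i →
    trans (+-cong (*-identityˡ _) (IsLinear.0-hom (lincomb-linearˡ (b ∘ suc)) i)) (+-identityʳ _)
  Span-generator b (suc j) = Span-weaken b (Span-generator (b ∘ suc) j)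

  LinIndep-injective : ∀ {s n} (b : Fin s → Vect n) → LinIndep b → ∀ a a′ → lincomb a b ≋ lincomb a′ b → ∀ j → a j ≈ a′ j
  LinIndep-injective b indep a a′ eq j = x∙y⁻¹≈ε⇒x≈y (a j) (a′ j) (trans (+-congˡ (sym (-1*x≈-x (a′ j))))
    (indep (λ j → a j + - 1# * a′ j) (λ i → trans (+-hom a (λ j → - 1# * a′ j) i)
      (trans (+-cong (eq i) (trans (·-hom (- 1#) a′ i) (-1*x≈-x _))) (-‿inverseʳ _))) j))
    where open IsLinear (lincomb-linearˡ b)

  -- The digits of k in base q, read through `enum`. This numbering of F^n serves both exhaustive
  -- search and the final counting argument.
  vector : ∀ {n} → Fin (q ℕ.^ n) → Vect n
  vector k i = enum (finToFun k i)

  vectorIndex : ∀ {n} → Vect n → Fin (q ℕ.^ n)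
  vectorIndex x = funToFin (index ∘ x)

  vector-vectorIndex : ∀ {n} (x : Vect n) → vector (vectorIndex x) ≋ x
  vector-vectorIndex x i = trans (reflexive (≡.cong enum (Fin.finToFun-funToFin (index ∘ x) i))) (enum-index (x i))

  funToFin-cong : ∀ {m n} {f g : Fin m → Fin n} → (∀ i → f i ≡ g i) → funToFin f ≡ funToFin g
  funToFin-cong {zero}  f≗g = ≡.refl
  funToFin-cong {suc m} f≗g = ≡.cong₂ combine (f≗g zero) (funToFin-cong (f≗g ∘ suc))

  vectorIndex-injective : ∀ {n} {x y : Vect n} → vectorIndex x ≡ vectorIndex y → x ≋ y
  vectorIndex-injective {x = x} {y} eq =
    ≋-trans (≋-sym (vector-vectorIndex x)) (≡.subst (λ k → vector k ≋ y) (≡.sym eq) (vector-vectorIndex y))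

  vector-injective : ∀ {n} {k l : Fin (q ℕ.^ n)} → vector k ≋ vector l → k ≡ l
  vector-injective {n} {k} {l} k≋l = ≡.trans (≡.sym (Fin.funToFin-finToFin {n} {q} k))
    (≡.trans (funToFin-cong {n} {q} (λ i → enum-inj _ _ (k≋l i))) (Fin.funToFin-finToFin {n} {q} l))

  vectors : ∀ {n} → List (Vect n)
  vectors = tabulate vector

  vectors-complete : ∀ {n} (x : Vect n) → Any (x ≋_) vectors
  vectors-complete x = Any.tabulate⁺ (vectorIndex x) (≋-sym (vector-vectorIndex x))

  _≋?_ : ∀ {n} (x y : Vect n) → Dec (x ≋ y)
  x ≋? y = Fin.all? (λ i → x i ≟ y i)

  -- Decided by trying all q^s coefficient vectors.
  Span? : ∀ {s n} (b : Fin s → Vect n) x → Dec (Span b x)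
  Span? b x with Fin.any? (λ k → lincomb (vector k) b ≋? x)
  ... | yes (k , eq) = yes (vector k , eq)
  ... | no ∄k = no λ (a , eq) → ∄k (vectorIndex a ,
          ≋-trans (lincomb-cong (vector-vectorIndex a) (λ j → ≋-refl)) eq)

  -- A relation with nonzero head coefficient could be divided by it, which would express `b zero`
  -- through the remaining vectors.
  LinIndep-extend : ∀ {s n} (b : Fin (suc s) → Vect n) → LinIndep (b ∘ suc) → ¬ Span (b ∘ suc) (b zero) → LinIndep b
  LinIndep-extend {s} b indep b₀∉ a a≈0 = coefficients
    where
    T = λ x → lincomb x (b ∘ suc)
    a₀≈0 : a zero ≈ 0#
    a₀≈0 with a zero ≟ 0#
    ... | yes p = p
    ... | no a₀≉0 = ⊥-elim (b₀∉ ((λ j → - c * a (suc j)) , λ i → trans (·-hom (- c) (a ∘ suc) i) (solved i)))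
      where
      open import Relation.Binary.Reasoning.Setoid setoid
      open IsLinear (lincomb-linearˡ (b ∘ suc))
      c = proj₁ (inverse (a zero) a₀≉0)
      solved : ∀ i → - c * T (a ∘ suc) i ≈ b zero i
      solved i = begin
        - c * T (a ∘ suc) i           ≈⟨ -‿distribˡ-* c _ ⟨
        - (c * T (a ∘ suc) i)         ≈⟨ +-inverseˡ-unique _ _ (begin
          c * (a zero * b zero i) + c * T (a ∘ suc) i   ≈⟨ distribˡ c _ _ ⟨
          c * (a zero * b zero i + T (a ∘ suc) i)       ≈⟨ *-congˡ (a≈0 i) ⟩
          c * 0#                                        ≈⟨ zeroʳ c ⟩
          0#                                            ∎) ⟨
        c * (a zero * b zero i)       ≈⟨ *-assoc _ _ _ ⟨
        c * a zero * b zero i         ≈⟨ *-congʳ (trans (*-comm _ _) (proj₂ (inverse (a zero) a₀≉0))) ⟩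
        1# * b zero i                 ≈⟨ *-identityˡ _ ⟩
        b zero i                      ∎
    coefficients : ∀ j → a j ≈ 0#
    coefficients zero    = a₀≈0
    coefficients (suc j) = indep (a ∘ suc) (≋-trans (≋-sym (lincomb-zero-head {a = a} b a₀≈0)) a≈0) j

  -- ≡ rather than ≋ in the membership claim lets predicates on gs transfer to the basis.
  basis-of-list : ∀ {n} (gs : List (Vect n)) → ∃ λ r → Σ (Fin r → Vect n) λ b →
                  LinIndep b × All (Span b) gs × (∀ j → b j ∈ gs)
  basis-of-list [] = 0 , (λ ()) , (λ _ _ ()) , [] , λ ()
  basis-of-list (g ∷ gs) with basis-of-list gs
  ... | r , b , indep , spans , b∈ with Span? b g
  ...   | yes g∈ = r , b , indep , g∈ ∷ spans , there ∘ b∈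
  ...   | no g∉  = suc r , b′ , LinIndep-extend b′ indep g∉ ,
                   Span-generator b′ zero ∷ All.map (Span-weaken b′) spans ,
                   λ { zero → here ≡.refl ; (suc j) → there (b∈ j) }
    where b′ = g Vector.∷ b

  prev^ : ∀ {n} → ℕ → Fin n → Fin n
  prev^ zero    i = i
  prev^ (suc r) i = prev^ r (prevIdx i)

  σ^-at : ∀ {n} r (x : Vect n) i → σ^ r x i ≡ x (prev^ r i)
  σ^-at zero    x i = ≡.refl
  σ^-at (suc r) x i = σ^-at r x (prevIdx i)

  -- The congruence `prevIdx i` ≡ i - 1 mod n, in additive form with an explicit number z of wraps,
  -- so that no subtraction in ℕ occurs.
  toℕ-prevIdx : ∀ {n} (i : Fin n) → ∃ λ z → suc (toℕ (prevIdx i)) ≡ toℕ i ℕ.+ z ℕ.* n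
  toℕ-prevIdx {suc m} zero    = 1 , ≡.trans (≡.cong suc (Fin.toℕ-fromℕ m)) (≡.sym (ℕ.+-identityʳ _))
  toℕ-prevIdx {suc m} (suc i) = 0 , ≡.trans (≡.cong suc (Fin.toℕ-inject₁ i)) (≡.sym (ℕ.+-identityʳ _))

  toℕ-prev^ : ∀ {n} r (i : Fin n) → ∃ λ z → r ℕ.+ toℕ (prev^ r i) ≡ toℕ i ℕ.+ z ℕ.* n
  toℕ-prev^ zero i = 0 , ≡.sym (ℕ.+-identityʳ _)
  toℕ-prev^ {n} (suc r) i with toℕ-prevIdx i | toℕ-prev^ r (prevIdx i)
  ... | z , eq | z′ , eq′ = z ℕ.+ z′ , ≡.trans (≡.cong suc eq′) (≡.trans (≡.cong (ℕ._+ z′ ℕ.* n) eq)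
          (≡.trans (ℕ.+-assoc (toℕ i) _ _) (≡.cong (toℕ i ℕ.+_) (≡.sym (ℕ.*-distribʳ-+ n z z′)))))

-- The ring F[X]/(X^n - 1) on F^n.

residue-unique : ∀ {n a b} z z′ → a ℕ.< n → b ℕ.< n → a ℕ.+ z ℕ.* n ≡ b ℕ.+ z′ ℕ.* n → a ≡ b
residue-unique {suc n} {a} {b} z z′ a<n b<n eq = begin
  a                             ≡⟨ m<n⇒m%n≡m a<n ⟨
  a ℕ.% suc n                   ≡⟨ [m+kn]%n≡m%n a z (suc n) ⟨
  (a ℕ.+ z ℕ.* suc n) ℕ.% suc n  ≡⟨ ≡.cong (ℕ._% suc n) eq ⟩
  (b ℕ.+ z′ ℕ.* suc n) ℕ.% suc n ≡⟨ [m+kn]%n≡m%n b z′ (suc n) ⟩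
  b ℕ.% suc n                   ≡⟨ m<n⇒m%n≡m b<n ⟩
  b                             ∎
  where open ≡.≡-Reasoning

module ShiftRing {q : ℕ} (F : FiniteField q) (n-1 : ℕ) where
  open FiniteField F hiding (zero)
  open LinAlg F renaming (_≋_ to infix 4 _≋_; _+ᵛ_ to infixl 6 _+ᵛ_; _·ᵛ_ to infix 8 _·ᵛ_)
  open FieldProperties F
  open LinearAlgebra F
  open IsLinear
  open import Algebra.Properties.Semiring.Sum semiring
  private n = suc n-1

  prev^n : ∀ i → prev^ {n} n i ≡ i
  prev^n i with toℕ-prev^ n i
  ... | z , eq = Fin.toℕ-injective (residue-unique 1 z (toℕ<n _) (toℕ<n i)
                   (≡.trans (ℕ.+-comm (toℕ (prev^ n i)) (1 ℕ.* n))
                     (≡.trans (≡.cong (ℕ._+ toℕ (prev^ n i)) (ℕ.*-identityˡ n)) eq)))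

  σ^n : ∀ (x : Vect n) → σ^ n x ≋ x
  σ^n x i = reflexive (≡.trans (σ^-at n x i) (≡.cong x (prev^n i)))

  σ^-linear : ∀ r → IsLinear {n} {n} (σ^ r)
  σ^-linear zero    = record { cong = λ p → p ; +-hom = λ _ _ → ≋-refl ; ·-hom = λ _ _ → ≋-refl }
  σ^-linear (suc r) = record
    { cong  = λ p i → cong (σ^-linear r) p (prevIdx i)
    ; +-hom = λ x y i → +-hom (σ^-linear r) x y (prevIdx i)
    ; ·-hom = λ s x i → ·-hom (σ^-linear r) s x (prevIdx i)
    }

  σ^-commute : ∀ {T : Vect n → Vect n} → IsLinear T → (∀ x → T (σ x) ≋ σ (T x)) → ∀ r x → T (σ^ r x) ≋ σ^ r (T x)
  σ^-commute T-linear Tσ zero    x = ≋-refl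
  σ^-commute T-linear Tσ (suc r) x = ≋-trans (Tσ _) (λ i → σ^-commute T-linear Tσ r x (prevIdx i))

  powers : Vect n → Fin n → Vect n
  powers b i = σ^ (toℕ i) b

  σ^-+ : ∀ r s (y : Vect n) → σ^ (r ℕ.+ s) y ≋ σ^ r (σ^ s y)
  σ^-+ zero    s y = ≋-refl
  σ^-+ (suc r) s y i = σ^-+ r s y (prevIdx i)

  infixl 7 _⊛_
  -- Cyclic convolution: the polynomial Σ a_i X^i acts on b as Σ a_i σ^i b. In this form the ring
  -- laws follow from linearity and commutation with σ instead of index arithmetic.
  _⊛_ : Vect n → Vect n → Vect n
  a ⊛ b = lincomb a (powers b)

  ⊛-linearʳ : ∀ a → IsLinear (a ⊛_)
  ⊛-linearʳ a = lincomb-linearʳ a (σ^ ∘ toℕ) (σ^-linear ∘ toℕ)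

  ⊛-linearˡ : ∀ b → IsLinear (_⊛ b)
  ⊛-linearˡ b = lincomb-linearˡ (powers b)

  -- A linear map that commutes with σ is A-linear. Applied to multiplication by a fixed element on
  -- the left or on the right, this yields commutativity and associativity of `_⊛_`.
  ⊛-commute : ∀ {T : Vect n → Vect n} → IsLinear T → (∀ x → T (σ x) ≋ σ (T x)) → ∀ a b → T (a ⊛ b) ≋ a ⊛ T b
  ⊛-commute {T} T-linear Tσ a b = ≋-trans (lincomb-hom T-linear a (powers b))
    (lincomb-cong {a = a} {b = T ∘ powers b} (λ _ → refl) (λ i → σ^-commute T-linear Tσ (toℕ i) b))

  ⊛-σʳ : ∀ a b → a ⊛ σ b ≋ σ (a ⊛ b)
  ⊛-σʳ a b = ≋-sym (⊛-commute (σ^-linear 1) (λ _ → ≋-refl) a b)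

  -- The coefficient of a that wraps round to the front multiplies b = σ^n b, so it is the last
  -- summand of the right-hand side; the other summands only move by one place.
  ⊛-σˡ : ∀ a b → σ a ⊛ b ≋ σ (a ⊛ b)
  ⊛-σˡ a b i = begin
    (σ a ⊛ b) i                                                             ≈⟨ lincomb-sum (σ a) (powers b) i ⟩
    aₗ * b i + sum (λ j → a (inject₁ j) * σ^ (suc (toℕ j)) b i)             ≈⟨ +-comm _ _ ⟩
    sum (λ j → a (inject₁ j) * σ^ (suc (toℕ j)) b i) + aₗ * b i             ≈⟨ +-cong (sum-cong-≋ {n-1} (λ j → *-congˡ
                                                                                 (reflexive (≡.cong (λ k → σ^ k b (prevIdx i)) (≡.sym (Fin.toℕ-inject₁ j))))))
                                                                                 (*-congˡ (sym last≈)) ⟩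
    sum (Vector.init term) + Vector.last term                               ≈⟨ sum-init-last term ⟨
    sum term                                                                ≈⟨ lincomb-sum a (powers b) (prevIdx i) ⟨
    σ (a ⊛ b) i                                                             ∎
    where
    open import Relation.Binary.Reasoning.Setoid setoid
    aₗ = a (fromℕ n-1)
    term : Fin n → Carrier
    term j = a j * σ^ (toℕ j) b (prevIdx i)
    last≈ : σ^ (toℕ (fromℕ n-1)) b (prevIdx i) ≈ b i
    last≈ = trans (reflexive (≡.cong (λ k → σ^ k b (prevIdx i)) (Fin.toℕ-fromℕ n-1))) (σ^n b i)

  δ : Vect n
  δ zero    = 1#
  δ (suc _) = 0#

  δ-≢0 : ∀ {i} → i ≢ zero → δ i ≈ 0#
  δ-≢0 {zero}  i≢0 = contradiction ≡.refl i≢0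
  δ-≢0 {suc i} i≢0 = refl

  δ-off-diagonal : ∀ i j → j ≢ i → σ^ (toℕ j) δ i ≈ 0#
  δ-off-diagonal i j j≢i = trans (reflexive (σ^-at (toℕ j) δ i)) (δ-≢0 λ prev≡0 →
    let z , eq = toℕ-prev^ (toℕ j) i in
    j≢i (Fin.toℕ-injective (residue-unique 0 z (toℕ<n j) (toℕ<n i)
      (≡.trans (≡.cong (toℕ j ℕ.+_) (≡.cong toℕ (≡.sym prev≡0))) eq))))

  δ-diagonal : ∀ i → σ^ (toℕ i) δ i ≈ 1#
  δ-diagonal i = trans (reflexive (σ^-at (toℕ i) δ i)) (reflexive (≡.cong δ prev≡0))
    where
    prev≡0 : prev^ (toℕ i) i ≡ zero
    prev≡0 with toℕ-prev^ (toℕ i) i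
    ... | z , eq = Fin.toℕ-injective (residue-unique 0 z (toℕ<n (prev^ (toℕ i) i)) (s≤s z≤n)
                     (≡.trans (ℕ.+-identityʳ _) (ℕ.+-cancelˡ-≡ (toℕ i) _ _ eq)))

  ⊛-identityʳ : ∀ a → a ⊛ δ ≋ a
  ⊛-identityʳ a i = begin
    (a ⊛ δ) i                                       ≈⟨ lincomb-sum a (powers δ) i ⟩
    sum term                                        ≈⟨ sum-remove {i = i} term ⟩
    term i + sum (λ j → term (punchIn i j))         ≈⟨ +-cong (trans (*-congˡ (δ-diagonal i)) (*-identityʳ _))
                                                         (sum-cong-≋ {n-1} (λ j → trans (*-congˡ (δ-off-diagonal i (punchIn i j) (Fin.punchInᵢ≢i i j))) (zeroʳ _))) ⟩
    a i + sum {n-1} (λ _ → 0#)                      ≈⟨ +-congˡ (sum-replicate-zero n-1) ⟩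
    a i + 0#                                        ≈⟨ +-identityʳ _ ⟩
    a i                                             ∎
    where
    open import Relation.Binary.Reasoning.Setoid setoid
    term : Fin n → Carrier
    term j = a j * σ^ (toℕ j) δ i

  ⊛-cong : ∀ {a a′ b b′} → a ≋ a′ → b ≋ b′ → a ⊛ b ≋ a′ ⊛ b′
  ⊛-cong {a} {b′ = b′} a≋ b≋ = ≋-trans (cong (⊛-linearʳ a) b≋) (cong (⊛-linearˡ b′) a≋)

  ⊛-comm : ∀ a b → a ⊛ b ≋ b ⊛ a
  ⊛-comm a b = ≋-trans (cong (⊛-linearʳ a) (≋-sym (⊛-identityʳ b)))
    (≋-trans (⊛-commute (⊛-linearʳ a) (⊛-σʳ a) b δ) (cong (⊛-linearʳ b) (⊛-identityʳ a)))

  ⊛-assoc : ∀ a b c → (a ⊛ b) ⊛ c ≋ a ⊛ (b ⊛ c)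
  ⊛-assoc a b c = ⊛-commute (⊛-linearˡ c) (λ x → ⊛-σˡ x c) a b

  shiftRing : CommutativeRing 0ℓ 0ℓ
  shiftRing = record
    { Carrier = Vect n
    ; _≈_ = _≋_
    ; _+_ = _+ᵛ_
    ; _*_ = _⊛_
    ; -_ = λ x i → - x i
    ; 0# = 0ᵛ
    ; 1# = δ
    ; isCommutativeRing = record
      { isRing = record
        { +-isAbelianGroup = record
          { isGroup = record
            { isMonoid = record
              { isSemigroup = record
                { isMagma = record
                  { isEquivalence = record { refl = ≋-refl ; sym = ≋-sym ; trans = ≋-trans }
                  ; ∙-cong = λ p r i → +-cong (p i) (r i)
                  }
                ; assoc = λ x y z i → +-assoc _ _ _
                }
              ; identity = (λ x i → +-identityˡ _) , (λ x i → +-identityʳ _)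
              }
            ; inverse = (λ x i → -‿inverseˡ _) , (λ x i → -‿inverseʳ _)
            ; ⁻¹-cong = λ p i → -‿cong (p i)
            }
          ; comm = λ x y i → +-comm _ _
          }
        ; *-cong = ⊛-cong
        ; *-assoc = ⊛-assoc
        ; *-identity = (λ a → ≋-trans (⊛-comm δ a) (⊛-identityʳ a)) , ⊛-identityʳ
        ; distrib = (λ a → +-hom (⊛-linearʳ a)) , (λ a → +-hom (⊛-linearˡ a))
        }
      ; *-comm = ⊛-comm
      }
    }

  private module A = CommutativeRing shiftRing

  shift : Vect n
  shift = σ δ

  open import Algebra.Properties.CommutativeSemiring.Exp A.commutativeSemiring
    using (_^_; ^-congˡ; ^-homo-*; ^-assocʳ)
  open import Algebra.Properties.Semiring.Exp semiring using () renaming (_^_ to _^ꟳ_; ^-assocʳ to ^ꟳ-assocʳ; ^-congˡ to ^ꟳ-congˡ)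

  shift-⊛ : ∀ a → shift ⊛ a ≋ σ a
  shift-⊛ a = ≋-trans (⊛-σˡ δ a) (cong (σ^-linear 1) (A.*-identityˡ a))

  shift^-⊛ : ∀ r a → (shift ^ r) ⊛ a ≋ σ^ r a
  shift^-⊛ zero    a = A.*-identityˡ a
  shift^-⊛ (suc r) a = ≋-trans (⊛-assoc shift (shift ^ r) a)
    (≋-trans (shift-⊛ _) (cong (σ^-linear 1) (shift^-⊛ r a)))

  shift^n : shift ^ n ≋ δ
  shift^n = ≋-trans (≋-sym (⊛-identityʳ _)) (≋-trans (shift^-⊛ n δ) (σ^n δ))

  open import Relation.Binary.Reasoning.Setoid A.setoid

  δ^ : ∀ j → δ ^ j ≋ δ
  δ^ zero    = ≋-refl
  δ^ (suc j) = ≋-trans (A.*-identityˡ _) (δ^ j)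

  ·ᵛ-⊛ : ∀ s a b → (s ·ᵛ a) ⊛ b ≋ s ·ᵛ (a ⊛ b)
  ·ᵛ-⊛ s a b = ·-hom (⊛-linearˡ b) s a

  ·ᵛ-cong : ∀ {m s t} {x y : Vect m} → s ≈ t → x ≋ y → s ·ᵛ x ≋ t ·ᵛ y
  ·ᵛ-cong s≈t x≋y i = *-cong s≈t (x≋y i)

  ·ᵛ-^ : ∀ s a j → (s ·ᵛ a) ^ j ≋ (s ^ꟳ j) ·ᵛ (a ^ j)
  ·ᵛ-^ s a zero    = λ i → sym (*-identityˡ _)
  ·ᵛ-^ s a (suc j) = begin
    (s ·ᵛ a) ⊛ ((s ·ᵛ a) ^ j)              ≈⟨ cong (⊛-linearʳ (s ·ᵛ a)) (·ᵛ-^ s a j) ⟩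
    (s ·ᵛ a) ⊛ ((s ^ꟳ j) ·ᵛ (a ^ j))       ≈⟨ ·ᵛ-⊛ s a _ ⟩
    s ·ᵛ (a ⊛ ((s ^ꟳ j) ·ᵛ (a ^ j)))       ≈⟨ ·ᵛ-cong refl (·-hom (⊛-linearʳ a) (s ^ꟳ j) (a ^ j)) ⟩
    s ·ᵛ ((s ^ꟳ j) ·ᵛ (a ⊛ (a ^ j)))       ≈⟨ (λ i → *-assoc _ _ _) ⟨
    (s ^ꟳ suc j) ·ᵛ (a ^ suc j)            ∎

  ×-at : ∀ m (a : Vect n) i → Mult._×_ A.semiring m a i ≡ Mult._×_ semiring m (a i)
  ×-at zero    a i = ≡.refl
  ×-at (suc m) a i = ≡.cong (a i +_) (×-at m a i)

  shiftRing-characteristic : ∀ {p} → Mult._×_ semiring p 1# ≈ 0# → Mult._×_ A.semiring p δ ≋ 0ᵛ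
  shiftRing-characteristic {p} p≈0 i = trans (reflexive (×-at p δ i))
    (Frobenius.×-annihilates commRing p p≈0 p (divides 1 (≡.sym (ℕ.*-identityˡ p))) (δ i))
    where open import Data.Nat.Divisibility using (divides)

  scalar^q^ : ∀ j s → s ^ꟳ (q ℕ.^ j) ≈ s
  scalar^q^ zero    s = *-identityʳ s
  scalar^q^ (suc j) s = trans (sym (^ꟳ-assocʳ s q (q ℕ.^ j))) (trans (^ꟳ-congˡ (q ℕ.^ j) (fermat F s)) (scalar^q^ j s))

  -- X^Q = X because n divides Q - 1, so the Q-th power map is the identity on every Σ aᵢ X^i.
  power-Q : IsPrimePower q → ∀ N C → q ℕ.^ N ≡ suc (n ℕ.* C) → ∀ a → a ^ (q ℕ.^ N) ≋ a
  power-Q (p , e , p-prime , _ , q≡p^e) N C Q≡ a = begin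
    a ^ Q                     ≈⟨ ^-congˡ Q (⊛-identityʳ a) ⟨
    -- `a ⊛ δ` is by definition the combination of the monomials σ^i δ = X^i with coefficients a_i.
    -- The scalars are fixed by Fermat, the monomials by `monomial`.
    (a ⊛ δ) ^ Q               ≈⟨ power-lincomb a (λ i → σ^ (toℕ i) δ) (λ i → monomial (toℕ i)) ⟩
    a ⊛ δ                     ≈⟨ ⊛-identityʳ a ⟩
    a                         ∎
    where
    Q = q ℕ.^ N
    Q≡p^ : Q ≡ p ℕ.^ (e ℕ.* N)
    Q≡p^ = ≡.trans (≡.cong (ℕ._^ N) q≡p^e) (ℕ.^-*-assoc p e N)
    power-+ : ∀ x y → (x +ᵛ y) ^ Q ≋ (x ^ Q) +ᵛ (y ^ Q)
    power-+ x y rewrite Q≡p^ = Frobenius.frobenius^-+ shiftRing p-prime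
      (shiftRing-characteristic {p} (characteristic e (≡.sym q≡p^e))) (e ℕ.* N) x y
    monomial : ∀ r → σ^ r δ ^ Q ≋ σ^ r δ
    monomial r = begin
      σ^ r δ ^ Q                              ≈⟨ ^-congˡ Q shift^r ⟨
      (shift ^ r) ^ Q                         ≈⟨ ^-assocʳ shift r Q ⟩
      shift ^ (r ℕ.* Q)                       ≡⟨ ≡.cong (λ k → shift ^ (r ℕ.* k)) Q≡ ⟩
      shift ^ (r ℕ.* suc (n ℕ.* C))           ≡⟨ ≡.cong (shift ^_) (ℕ.*-comm r (suc (n ℕ.* C))) ⟩
      shift ^ (r ℕ.+ n ℕ.* C ℕ.* r)           ≡⟨ ≡.cong (λ k → shift ^ (r ℕ.+ k)) (ℕ.*-assoc n C r) ⟩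
      shift ^ (r ℕ.+ n ℕ.* (C ℕ.* r))         ≈⟨ ^-homo-* shift r (n ℕ.* (C ℕ.* r)) ⟩
      shift ^ r ⊛ shift ^ (n ℕ.* (C ℕ.* r))   ≈⟨ cong (⊛-linearʳ (shift ^ r)) (^-assocʳ shift n (C ℕ.* r)) ⟨
      shift ^ r ⊛ (shift ^ n) ^ (C ℕ.* r)     ≈⟨ cong (⊛-linearʳ (shift ^ r)) (≋-trans (^-congˡ (C ℕ.* r) shift^n) (δ^ (C ℕ.* r))) ⟩
      shift ^ r ⊛ δ                           ≈⟨ shift^-⊛ r δ ⟩
      σ^ r δ                                  ∎
      where
      shift^r : shift ^ r ≋ σ^ r δ
      shift^r = ≋-trans (≋-sym (⊛-identityʳ _)) (shift^-⊛ r δ)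
    power-zero : 0ᵛ ^ Q ≋ 0ᵛ
    power-zero rewrite Q≡ = A.zeroˡ (0ᵛ ^ (n ℕ.* C))
    power-lincomb : ∀ {s} (c : Fin s → Carrier) (b : Fin s → Vect n) → (∀ j → b j ^ Q ≋ b j) →
                    lincomb c b ^ Q ≋ lincomb c b
    power-lincomb {zero}  c b b^Q = power-zero
    power-lincomb {suc s} c b b^Q = ≋-trans (power-+ _ _)
      (λ i → +-cong (≋-trans (·ᵛ-^ (c zero) (b zero) Q) (·ᵛ-cong (scalar^q^ N (c zero)) (b^Q zero)) i)
                    (power-lincomb (c ∘ suc) (b ∘ suc) (b^Q ∘ suc) i))

-- Roots of monic polynomials.

module MonicPolynomials (R : CommutativeRing 0ℓ 0ℓ) where
  open CommutativeRing R hiding (zero)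
  open import Algebra.Properties.Ring ring
  open import Algebra.Properties.Semiring.Exp semiring using (_^_)
  open import Algebra.Solver.Ring.NaturalCoefficients.Default commutativeSemiring
  open import Relation.Binary.Reasoning.Setoid setoid

  -- The monic polynomial Y^k + c_{k-1} Y^{k-1} + ⋯ + c₀ is represented by c₀ ∷ ⋯ ∷ c_{k-1} ∷ [].
  monicEval : ∀ {k} → Vec Carrier k → Carrier → Carrier
  monicEval []       y = 1#
  monicEval (c ∷ cs) y = c + y * monicEval cs y

  -- Horner division by Y - z: each coefficient of the quotient is the value at z of a tail of the
  -- polynomial.
  monicQuotient : ∀ {k} → Carrier → Vec Carrier (suc k) → Vec Carrier k
  monicQuotient z (c ∷ [])            = []
  monicQuotient z (c ∷ cs@(_ ∷ _)) = monicEval cs z ∷ monicQuotient z cs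

  -- P(y) - P(z) = (y - z) D(y) with D the quotient, written without subtraction so that it is a semiring identity.
  monicEval-quotient : ∀ {k} z (cs : Vec Carrier (suc k)) y →
    monicEval cs y + z * monicEval (monicQuotient z cs) y ≈ monicEval cs z + y * monicEval (monicQuotient z cs) y
  monicEval-quotient z (c ∷ []) y = solve 3 (λ c y z → (c :+ y :* con 1) :+ z :* con 1 := (c :+ z :* con 1) :+ y :* con 1) refl c y z
  monicEval-quotient z (c ∷ cs@(_ ∷ _)) y = begin
    (c + y * E) + z * (E′ + y * D)  ≈⟨ solve 6 (λ c y z E E′ D → (c :+ y :* E) :+ z :* (E′ :+ y :* D) := c :+ z :* E′ :+ y :* (E :+ z :* D)) refl c y z E E′ D ⟩
    c + z * E′ + y * (E + z * D)    ≈⟨ +-congˡ (*-congˡ (monicEval-quotient z cs y)) ⟩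
    c + z * E′ + y * (E′ + y * D)   ∎
    where
    E  = monicEval cs y
    E′ = monicEval cs z
    D  = monicEval (monicQuotient z cs) y

  monicEval-power : ∀ k y → monicEval (replicate k 0#) y ≈ y ^ k
  monicEval-power zero    y = refl
  monicEval-power (suc k) y = trans (+-identityˡ _) (*-congˡ (monicEval-power k y))

  -- f plays the role of the unit of the field fR.
  module _ (f : Carrier) (f≉0 : ¬ (f ≈ 0#))
           (cancel : ∀ u v → ¬ (f * u ≈ 0#) → f * (u * v) ≈ 0# → f * v ≈ 0#) where

    root-quotient : ∀ {k} {z y} (cs : Vec Carrier (suc k)) → f * monicEval cs z ≈ 0# → ¬ (f * (z - y) ≈ 0#) →
                    f * monicEval cs y ≈ 0# → f * monicEval (monicQuotient z cs) y ≈ 0#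
    root-quotient {_} {z} {y} cs fPz≈0 distinct fPy≈0 = cancel (z - y) D distinct (begin
      f * ((z - y) * D)           ≈⟨ *-congˡ ([y-z]x≈yx-zx D z y) ⟩
      f * (z * D - y * D)         ≈⟨ x[y-z]≈xy-xz f (z * D) (y * D) ⟩
      f * (z * D) - f * (y * D)   ≈⟨ x≈y⇒x∙y⁻¹≈ε equal ⟩
      0#                          ∎)
      where
      D = monicEval (monicQuotient z cs) y
      equal : f * (z * D) ≈ f * (y * D)
      equal = begin
        f * (z * D)                       ≈⟨ +-identityˡ _ ⟨
        0# + f * (z * D)                  ≈⟨ +-congʳ fPy≈0 ⟨
        f * monicEval cs y + f * (z * D)  ≈⟨ distribˡ f _ _ ⟨
        f * (monicEval cs y + z * D)      ≈⟨ *-congˡ (monicEval-quotient z cs y) ⟩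
        f * (monicEval cs z + y * D)      ≈⟨ distribˡ f _ _ ⟩
        f * monicEval cs z + f * (y * D)  ≈⟨ +-congʳ fPz≈0 ⟩
        0# + f * (y * D)                  ≈⟨ +-identityˡ _ ⟩
        f * (y * D)                       ∎

    -- Only fR is assumed free of zero divisors, so roots and their distinctness are measured after
    -- multiplication by f. Dividing out the first root leaves the others as roots of the quotient;
    -- in degree 0 the polynomial is 1, and f·1 is nonzero.
    roots≤degree : ∀ {k} (cs : Vec Carrier k) ys → AllPairs (λ y z → ¬ (f * (y - z) ≈ 0#)) ys →
                   All (λ y → f * monicEval cs y ≈ 0#) ys → length ys ℕ.≤ k
    roots≤degree cs       []       _                _            = z≤n
    roots≤degree []       (z ∷ ys) _                (fz≈0 ∷ _)   = contradiction (trans (sym (*-identityʳ f)) fz≈0) f≉0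
    roots≤degree cs@(_ ∷ _) (z ∷ ys) (z≉ys ∷ distinct) (fz≈0 ∷ roots) = s≤s (roots≤degree (monicQuotient z cs) ys distinct
      (All.map (λ (d , r) → root-quotient cs fz≈0 d r) (All.zip (z≉ys , roots))))

-- Primitive idempotents and free orbits in a finite commutative ring.

-- The field fA, split into 0 and the orbits of multiplication by X.
record OrbitDecomposition (R : CommutativeRing 0ℓ 0ℓ) (X : CommutativeRing.Carrier R) (n bound : ℕ) : Set where
  open CommutativeRing R hiding (zero)
  open CommutativeExp commutativeSemiring using (_^_)
  field
    f               : Carrier
    f-idem          : f * f ≈ f
    representatives : List Carrier
    points          : List Carrier
    nonempty        : 1 ℕ.≤ length representatives
    count           : length points ≡ n ℕ.* length representatives
    bounded         : length points ℕ.≤ bound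
    fixed           : All (λ w → f * w ≈ w) representatives
    units           : All (λ y → f * y ≈ y × ¬ (y ≈ 0#)) points
    distinct        : AllPairs (λ y z → ¬ (y ≈ z)) points
    source          : ∀ y → Any (y ≈_) points → ∃₂ λ r w → r ℕ.< n × w ∈ representatives × X ^ r * w ≈ y
    covers          : ∀ a → f * a ≈ 0# ⊎ Any (f * a ≈_) points

module FreeOrbits (R : CommutativeRing 0ℓ 0ℓ) where
  open CommutativeRing R hiding (zero)
  open CommutativeExp commutativeSemiring

  module _
    (_≟_ : ∀ x y → Dec (x ≈ y))
    (elements : List Carrier) (complete : ∀ a → Any (a ≈_) elements)
    -- Here Q = t + 2, so that the exponent Q - 1 is visibly positive.
    (t : ℕ) (a^[2+t]≈a : ∀ a → a ^ suc (suc t) ≈ a)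
    (X : Carrier) (n : ℕ) (0<n : 0 ℕ.< n) (X^n≈1 : X ^ n ≈ 1#)
    (g : Carrier) (g≉0 : ¬ (g ≈ 0#))
    (g-kills : ∀ r → 0 ℕ.< r → r ℕ.< n → ∀ y → X ^ r * y ≈ y → g * y ≈ 0#)
    where

    open MonicPolynomials R
    open import Algebra.Properties.Ring ring
    open import Algebra.Solver.Ring.NaturalCoefficients.Default commutativeSemiring using (solve; _:*_; _:=_)
    open import Relation.Binary.Reasoning.Setoid setoid

    -- Since a^{t+2} = a, the power a^{t+1} is an idempotent generating the same ideal as a.
    support : Carrier → Carrier
    support a = a ^ suc t

    support-idem : ∀ a → support a * support a ≈ support a
    support-idem a = begin
      (a * a ^ t) * (a * a ^ t)   ≈⟨ solve 2 (λ a b → (a :* b) :* (a :* b) := (a :* (a :* b)) :* b) refl a (a ^ t) ⟩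
      a ^ suc (suc t) * a ^ t     ≈⟨ *-congʳ (a^[2+t]≈a a) ⟩
      a * a ^ t                   ∎

    record Primitive (f : Carrier) (as : List Carrier) : Set where
      field
        idem    : f * f ≈ f
        nonzero : ¬ (f ≈ 0#)
        kills   : ∀ y → g * y ≈ 0# → f * y ≈ 0#
        minimal : All (λ a → f * a ≈ 0# ⊎ f * support a ≈ f) as

    -- Start from the idempotent of the ideal of g. For each element a in turn, either f annihilates
    -- `support a`, hence also a, or f shrinks to the nonzero idempotent `f * support a`. Shrinking
    -- preserves every alternative already settled.
    primitiveIdempotent : ∀ as → ∃ λ f → Primitive f as
    primitiveIdempotent [] = support g , record
      { idem    = support-idem g
      ; nonzero = λ s≈0 → g≉0 (begin
          g               ≈⟨ a^[2+t]≈a g ⟨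
          g * support g   ≈⟨ *-congˡ s≈0 ⟩
          g * 0#          ≈⟨ zeroʳ g ⟩
          0#              ∎)
      ; kills   = λ y gy≈0 → begin
          (g * g ^ t) * y  ≈⟨ solve 3 (λ g h y → (g :* h) :* y := h :* (g :* y)) refl g (g ^ t) y ⟩
          g ^ t * (g * y)  ≈⟨ *-congˡ gy≈0 ⟩
          g ^ t * 0#       ≈⟨ zeroʳ _ ⟩
          0#               ∎
      ; minimal = []
      }
    primitiveIdempotent (a ∷ as) with primitiveIdempotent as
    ... | f , f-prim with (f * support a) ≟ 0#
    ...   | yes fs≈0 = f , record { idem = idem ; nonzero = nonzero ; kills = kills ; minimal = inj₁ fa≈0 ∷ minimal }
      where
      open Primitive f-prim
      fa≈0 : f * a ≈ 0#
      fa≈0 = begin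
        f * a               ≈⟨ *-congˡ (a^[2+t]≈a a) ⟨
        f * (a * support a) ≈⟨ solve 3 (λ f a s → f :* (a :* s) := a :* (f :* s)) refl f a (support a) ⟩
        a * (f * support a) ≈⟨ *-congˡ fs≈0 ⟩
        a * 0#              ≈⟨ zeroʳ a ⟩
        0#                  ∎
    ...   | no fs≉0 = f * s , record
      { idem    = trans (solve 2 (λ f s → (f :* s) :* (f :* s) := (f :* f) :* (s :* s)) refl f s) (*-cong idem (support-idem a))
      ; nonzero = fs≉0
      ; kills   = λ y gy≈0 → shrink≈0 (kills y gy≈0)
      ; minimal = inj₂ (trans (*-assoc f s s) (*-congˡ (support-idem a))) ∷ All.map shrink minimal
      }
      where
      open Primitive f-prim
      s = support a
      shrink≈0 : ∀ {b} → f * b ≈ 0# → (f * s) * b ≈ 0#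
      shrink≈0 {b} fb≈0 = trans (solve 3 (λ f s b → (f :* s) :* b := s :* (f :* b)) refl f s b)
        (trans (*-congˡ fb≈0) (zeroʳ s))
      shrink : ∀ {b} → f * b ≈ 0# ⊎ f * support b ≈ f → (f * s) * b ≈ 0# ⊎ (f * s) * support b ≈ f * s
      shrink (inj₁ fb≈0) = inj₁ (shrink≈0 fb≈0)
      shrink {b} (inj₂ fs≈f) = inj₂ (trans (solve 3 (λ f s b → (f :* s) :* b := (f :* b) :* s) refl f s (support b)) (*-congʳ fs≈f))

    f : Carrier
    f = proj₁ (primitiveIdempotent elements)

    open Primitive (proj₂ (primitiveIdempotent elements)) public renaming (idem to f-idem; nonzero to f≉0)

    -- This dichotomy makes fR a field: in the second case a^t is an inverse of a relative to the
    -- unit f.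
    zero-or-unit : ∀ a → f * a ≈ 0# ⊎ f * support a ≈ f
    zero-or-unit a with find (complete a)
    ... | b , b∈ , a≈b with All.lookup minimal b∈
    ...   | inj₁ fb≈0 = inj₁ (trans (*-congˡ a≈b) fb≈0)
    ...   | inj₂ fs≈f = inj₂ (trans (*-congˡ (^-congˡ (suc t) a≈b)) fs≈f)

    f-cancel : ∀ u v → ¬ (f * u ≈ 0#) → f * (u * v) ≈ 0# → f * v ≈ 0#
    f-cancel u v fu≉0 fuv≈0 with zero-or-unit u
    ... | inj₁ fu≈0 = contradiction fu≈0 fu≉0
    ... | inj₂ fs≈f = begin
      f * v                       ≈⟨ *-congʳ fs≈f ⟨
      (f * (u * u ^ t)) * v       ≈⟨ solve 4 (λ f u w v → (f :* (u :* w)) :* v := w :* (f :* (u :* v))) refl f u (u ^ t) v ⟩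
      u ^ t * (f * (u * v))       ≈⟨ *-congˡ fuv≈0 ⟩
      u ^ t * 0#                  ≈⟨ zeroʳ _ ⟩
      0#                          ∎

    FieldUnit : Carrier → Set
    FieldUnit y = f * y ≈ y × ¬ (y ≈ 0#)

    units-bound : ∀ ys → All FieldUnit ys → AllPairs (λ y z → ¬ (y ≈ z)) ys → length ys ℕ.≤ suc t
    units-bound ys units distinct = roots≤degree f f≉0 f-cancel cs ys (separated units distinct) (All.map root units)
      where
      -- The polynomial Y^(t+1) - 1, that is Y^(Q-1) - 1.
      cs : Vec Carrier (suc t)
      cs = - 1# ∷ replicate t 0#
      root : ∀ {y} → FieldUnit y → f * monicEval cs y ≈ 0#
      root {y} (fy≈y , y≉0) with zero-or-unit y
      ... | inj₁ fy≈0 = contradiction (trans (sym fy≈y) fy≈0) y≉0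
      ... | inj₂ fs≈f = begin
        f * (- 1# + y * monicEval (replicate t 0#) y)   ≈⟨ *-congˡ (+-congˡ (*-congˡ (monicEval-power t y))) ⟩
        f * (- 1# + support y)                          ≈⟨ distribˡ f _ _ ⟩
        f * - 1# + f * support y                        ≈⟨ +-cong (trans (sym (-‿distribʳ-* f 1#)) (-‿cong (*-identityʳ f))) fs≈f ⟩
        - f + f                                         ≈⟨ -‿inverseˡ f ⟩
        0#                                              ∎
      separated : ∀ {ys} → All FieldUnit ys → AllPairs (λ y z → ¬ (y ≈ z)) ys → AllPairs (λ y z → ¬ (f * (y - z) ≈ 0#)) ys
      separated [] [] = []
      separated {y ∷ ys} ((fy≈y , _) ∷ units) (y≉ys ∷ distinct) =
        All.map (λ {z} (y≉z , (fz≈z , _)) eq → y≉z (x∙y⁻¹≈ε⇒x≈y y z (begin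
          y - z              ≈⟨ +-cong (sym fy≈y) (-‿cong (sym fz≈z)) ⟩
          f * y - f * z      ≈⟨ x[y-z]≈xy-xz f y z ⟨
          f * (y - z)        ≈⟨ eq ⟩
          0#                 ∎))) (All.zip (y≉ys , units)) ∷ separated units distinct

    rotate-back : ∀ {r y} → r ℕ.≤ n → X ^ (n ℕ.∸ r) * (X ^ r * y) ≈ y
    rotate-back {r} {y} r≤n = begin
      X ^ (n ℕ.∸ r) * (X ^ r * y)   ≈⟨ *-assoc _ _ _ ⟨
      (X ^ (n ℕ.∸ r) * X ^ r) * y   ≈⟨ *-congʳ (^-homo-* X (n ℕ.∸ r) r) ⟨
      X ^ (n ℕ.∸ r ℕ.+ r) * y       ≡⟨ ≡.cong (λ k → X ^ k * y) (ℕ.m∸n+n≡m r≤n) ⟩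
      X ^ n * y                     ≈⟨ *-congʳ X^n≈1 ⟩
      1# * y                        ≈⟨ *-identityˡ y ⟩
      y                             ∎

    rotate-cancel : ∀ {r y z} → r ℕ.≤ n → X ^ r * y ≈ X ^ r * z → y ≈ z
    rotate-cancel r≤n eq = trans (sym (rotate-back r≤n)) (trans (*-congˡ eq) (rotate-back r≤n))

    rotate-unit : ∀ {r y} → r ℕ.≤ n → FieldUnit y → FieldUnit (X ^ r * y)
    rotate-unit {r} {y} r≤n (fy≈y , y≉0) =
      trans (solve 3 (λ f x y → f :* (x :* y) := x :* (f :* y)) refl f (X ^ r) y) (*-congˡ fy≈y) ,
      λ eq → y≉0 (rotate-cancel r≤n (trans eq (sym (zeroʳ _))))

    -- Otherwise X^(s-r) fixes y, so g kills y, and therefore f does; but f y = y is nonzero.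
    rotate-free : ∀ {r s y} → FieldUnit y → r ℕ.< s → s ℕ.< n → ¬ (X ^ r * y ≈ X ^ s * y)
    rotate-free {r} {s} {y} (fy≈y , y≉0) r<s s<n eq = y≉0 (trans (sym fy≈y) (kills y
      (g-kills (s ℕ.∸ r) (ℕ.m<n⇒0<n∸m r<s) (ℕ.≤-<-trans (ℕ.m∸n≤m s r) s<n) y fixed)))
      where
      fixed : X ^ (s ℕ.∸ r) * y ≈ y
      fixed = rotate-cancel {r} (ℕ.<⇒≤ (ℕ.<-trans r<s s<n)) (begin
        X ^ r * (X ^ (s ℕ.∸ r) * y)   ≈⟨ *-assoc _ _ _ ⟨
        (X ^ r * X ^ (s ℕ.∸ r)) * y   ≈⟨ *-congʳ (^-homo-* X r (s ℕ.∸ r)) ⟨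
        X ^ (r ℕ.+ (s ℕ.∸ r)) * y     ≡⟨ ≡.cong (λ k → X ^ k * y) (ℕ.m+[n∸m]≡n (ℕ.<⇒≤ r<s)) ⟩
        X ^ s * y                     ≈⟨ eq ⟨
        X ^ r * y                     ∎)

    orbit : Carrier → List Carrier
    orbit w = applyUpTo (λ r → X ^ r * w) n

    record Orbits (as : List Carrier) : Set where
      field
        representatives : List Carrier
        points          : List Carrier
        count           : length points ≡ n ℕ.* length representatives
        fixed           : All (λ w → f * w ≈ w) representatives
        units           : All FieldUnit points
        distinct        : AllPairs (λ y z → ¬ (y ≈ z)) points
        -- Stability under X is what keeps a newly added orbit disjoint from the earlier points.
        closed          : ∀ y → Any (y ≈_) points → Any (X * y ≈_) points
        source          : ∀ y → Any (y ≈_) points → ∃₂ λ r w → r ℕ.< n × w ∈ representatives × X ^ r * w ≈ y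
        covers          : All (λ a → f * a ≈ 0# ⊎ Any (f * a ≈_) points) as

    orbits : ∀ as → Orbits as
    orbits [] = record
      { representatives = [] ; points = [] ; count = ≡.sym (ℕ.*-zeroʳ n)
      ; fixed = [] ; units = [] ; distinct = [] ; closed = λ _ () ; source = λ _ () ; covers = [] }
    orbits (a ∷ as) with orbits as
    ... | O with (f * a) ≟ 0# | Any.any? ((f * a) ≟_) (Orbits.points O)
    ...   | yes fa≈0 | _        = record { Orbits O ; covers = inj₁ fa≈0 ∷ Orbits.covers O }
    ...   | no _     | yes fa∈O = record { Orbits O ; covers = inj₂ fa∈O ∷ Orbits.covers O }
    ...   | no fa≉0  | no fa∉O  = record
      { representatives = w ∷ representatives
      ; points   = orbit w ++ points
      ; count    = ≡.trans (length-++ (orbit w)) (≡.trans (≡.cong₂ ℕ._+_ (length-applyUpTo _ n) count)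
                     (≡.sym (ℕ.*-suc n (length representatives))))
      ; fixed    = proj₁ w-unit ∷ fixed
      ; units    = All.++⁺ (All.applyUpTo⁺₁ _ n (λ r<n → rotate-unit (ℕ.<⇒≤ r<n) w-unit)) units
      ; distinct = AllPairs.++⁺ (AllPairs.applyUpTo⁺₁ _ n (rotate-free w-unit)) distinct
                     (All.applyUpTo⁺₁ _ n (λ r<n → All.tabulate (λ y∈ eq → fa∉O (disjoint r<n y∈ eq))))
      ; closed   = closed′
      ; source   = source′
      ; covers   = inj₂ (Any.++⁺ˡ (Any.applyUpTo⁺ _ {i = 0} (sym (*-identityˡ w)) 0<n)) ∷
                   All.map (λ { (inj₁ p) → inj₁ p ; (inj₂ p) → inj₂ (Any.++⁺ʳ (orbit w) p) }) covers
      }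
      where
      open Orbits O
      w = f * a
      w-unit : FieldUnit w
      w-unit = trans (sym (*-assoc f f a)) (*-congʳ f-idem) , fa≉0
      resp : ∀ {y z} → y ≈ z → ∀ {ys} → Any (y ≈_) ys → Any (z ≈_) ys
      resp y≈z = Any.map (trans (sym y≈z))
      closed^ : ∀ r y → Any (y ≈_) points → Any (X ^ r * y ≈_) points
      closed^ zero    y y∈ = resp (sym (*-identityˡ y)) y∈
      closed^ (suc r) y y∈ = resp (sym (*-assoc X (X ^ r) y)) (closed _ (closed^ r y y∈))
      -- If X^r w were an old point, rotating it by n - r further steps would make w an old point
      -- too.
      disjoint : ∀ {r y} → r ℕ.< n → y ∈ points → X ^ r * w ≈ y → Any (w ≈_) points
      disjoint {r} {y} r<n y∈ eq = resp (trans (*-congˡ (sym eq)) (rotate-back (ℕ.<⇒≤ r<n)))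
        (closed^ (n ℕ.∸ r) y (Any.map (λ { ≡.refl → refl }) y∈))
      closed′ : ∀ y → Any (y ≈_) (orbit w ++ points) → Any (X * y ≈_) (orbit w ++ points)
      closed′ y y∈ with Any.++⁻ (orbit w) y∈
      ... | inj₂ y∈O = Any.++⁺ʳ (orbit w) (closed y y∈O)
      ... | inj₁ y∈w with Any.applyUpTo⁻ _ y∈w
      ...   | r , r<n , y≈ with ℕ.m≤n⇒m<n∨m≡n r<n
      ...     | inj₁ r+1<n = Any.++⁺ˡ (Any.applyUpTo⁺ _ (trans (*-congˡ y≈) (sym (*-assoc _ _ _))) r+1<n)
      -- The last point of the orbit moves to X^n w = w, the entry at position 0.
      ...     | inj₂ ≡.refl = Any.++⁺ˡ (Any.applyUpTo⁺ (λ r → X ^ r * w) {i = 0}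
                  (trans (*-congˡ y≈) (trans (sym (*-assoc _ _ _)) (trans (*-congʳ X^n≈1) (trans (*-identityˡ w) (sym (*-identityˡ w)))))) 0<n)
      source′ : ∀ y → Any (y ≈_) (orbit w ++ points) → ∃₂ λ r w′ → r ℕ.< n × w′ ∈ (w ∷ representatives) × X ^ r * w′ ≈ y
      source′ y y∈ with Any.++⁻ (orbit w) y∈
      ... | inj₂ y∈O = let r , w′ , r<n , w′∈ , eq = source y y∈O in r , w′ , r<n , there w′∈ , eq
      ... | inj₁ y∈w = let r , r<n , y≈ = Any.applyUpTo⁻ _ y∈w in r , w , r<n , here ≡.refl , sym y≈

    orbitDecomposition : OrbitDecomposition R X n (suc t)
    orbitDecomposition = record
      { Orbits O
      ; f        = f
      ; f-idem   = f-idem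
      ; nonempty = nonempty
      ; bounded  = units-bound points units distinct
      ; covers   = covers-all
      }
      where
      O = orbits elements
      open Orbits O
      covers-all : ∀ a → f * a ≈ 0# ⊎ Any (f * a ≈_) points
      covers-all a with find (complete a)
      ... | b , b∈ , a≈b with All.lookup covers b∈
      ...   | inj₁ fb≈0 = inj₁ (trans (*-congˡ a≈b) fb≈0)
      ...   | inj₂ fb∈  = inj₂ (Any.map (trans (*-congˡ a≈b)) fb∈)
      nonempty : 1 ℕ.≤ length representatives
      -- f is itself a nonzero element of fA, hence lies in some orbit.
      nonempty with covers-all f
      ... | inj₁ ff≈0 = contradiction (trans (sym f-idem) ff≈0) f≉0
      ... | inj₂ ff∈  with source _ ff∈
      ...   | _ , _ , _ , w∈ , _ = ℕ.≤-<-trans z≤n (Fin.toℕ<n (Any.index w∈))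

-- A nonzero element killing every vector with a nontrivial period.

∣m+n∣n⇒∣m : ∀ {d m n} → d ∣ m ℕ.+ n → d ∣ n → d ∣ m
∣m+n∣n⇒∣m {d} {m} {n} d∣m+n = ∣m+n∣m⇒∣n (≡.subst (d ∣_) (ℕ.+-comm m n) d∣m+n)

primeDivisor : ∀ n → 1 ℕ.< n → ∃ λ p → Prime p × p ∣ n
primeDivisor n@(suc _) 1<n with factorise n
... | record { factors = [] ; isFactorisation = n≡1 } = contradiction 1<n (ℕ.<-irrefl (≡.sym n≡1))
... | record { factors = p ∷ ps ; isFactorisation = n≡ ; factorsPrime = p-prime ∷ _ } =
        p , p-prime , ≡.subst (p ∣_) (≡.sym n≡) (m∣m*n (product ps))

module Separation {q : ℕ} (F : FiniteField q) (n-1 : ℕ) where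
  open FiniteField F hiding (zero)
  open LinAlg F renaming (_≋_ to infix 4 _≋_; _+ᵛ_ to infixl 6 _+ᵛ_; _·ᵛ_ to infix 8 _·ᵛ_)
  open FieldProperties F
  open LinearAlgebra F
  open ShiftRing F n-1
  open import Algebra.Properties.Ring ring using (-0#≈0#; -‿injective)
  private n = suc n-1
  private module A = CommutativeRing shiftRing

  -- The product (X^m - 1) a.
  difference : ℕ → Vect n → Vect n
  difference m a i = σ^ m a i - a i

  difference-⊛ : ∀ m a y → difference m a ⊛ y ≋ difference m (a ⊛ y)
  difference-⊛ m a y = ≋-trans (A.distribʳ y (σ^ m a) (A.- a)) (λ i → +-cong
    (σ^-commute (⊛-linearˡ y) (λ x → ⊛-σˡ x y) m a i)
    (≋-sym (-‿distribˡ-* a y) i))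
    where open import Algebra.Properties.Ring A.ring using (-‿distribˡ-*)

  difference-zero : ∀ m {a} → a ≋ 0ᵛ → difference m a ≋ 0ᵛ
  difference-zero m {a} a≋0 i = trans (+-cong (trans (reflexive (σ^-at m a i)) (a≋0 _)) (-‿cong (a≋0 i))) (-‿inverseʳ 0#)

  difference-fixed : ∀ m a {y} → σ^ m y ≋ y → difference m a ⊛ y ≋ 0ᵛ
  difference-fixed m a {y} fixed = ≋-trans (difference-⊛ m a y) (λ i → trans (+-congʳ (trans
    (≋-sym (σ^-commute (⊛-linearʳ a) (⊛-σʳ a) m y) i) (IsLinear.cong (⊛-linearʳ a) fixed i))) (-‿inverseʳ _))

  -- radical is the product of the primes ℓ ≤ j dividing n, and g that of the corresponding X^(n/ℓ) - 1. Multiplying g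
  -- by the next factor gives a translate of g minus g; their supports are disjoint, hence nothing cancels.
  record Separator (j : ℕ) : Set where
    field
      g             : Vect n
      radical u     : ℕ
      factorisation : radical ℕ.* u ≡ n
      nonzero       : ∃ λ i → ¬ (g i ≈ 0#)
      supported     : ∀ i → ¬ (g i ≈ 0#) → u ∣ toℕ i
      primes≤       : ∀ {ℓ} → Prime ℓ → ℓ ∣ radical → ℓ ℕ.≤ j
      kills         : ∀ {ℓ} → Prime ℓ → ℓ ℕ.≤ j → ∀ m → m ℕ.* ℓ ≡ n → ∀ y → σ^ m y ≋ y → g ⊛ y ≋ 0ᵛ

  separator : ∀ j → Separator j
  separator zero = record
    { g = δ ; radical = 1 ; u = n ; factorisation = ℕ.*-identityˡ n
    ; nonzero = zero , λ 1≈0 → 0≉1 (sym 1≈0)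
    ; supported = λ { zero _ → n ∣0 ; (suc i) 0≉0 → contradiction refl 0≉0 }
    ; primes≤ = λ ℓ-prime ℓ∣1 → contradiction ℓ∣1 (prime∤1 ℓ-prime)
    ; kills = λ ℓ-prime ℓ≤0 → contradiction ℓ≤0 (ℕ.<⇒≱ (ℕ.>-nonZero⁻¹ _ {{prime⇒nonZero ℓ-prime}}))
    }
  separator (suc j) with separator j | prime? (suc j) ×-dec (suc j ∣? n)
  ... | S | no ¬prime-divisor = record
    { Separator S
    ; primes≤ = λ ℓ-prime ℓ∣R → ℕ.m≤n⇒m≤1+n (Separator.primes≤ S ℓ-prime ℓ∣R)
    ; kills = λ ℓ-prime ℓ≤1+j → kills ℓ-prime (ℕ.m≤n⇒m<n∨m≡n ℓ≤1+j)
    }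
    where
    kills : ∀ {ℓ} → Prime ℓ → ℓ ℕ.< suc j ⊎ ℓ ≡ suc j → ∀ m → m ℕ.* ℓ ≡ n → ∀ y → σ^ m y ≋ y → Separator.g S ⊛ y ≋ 0ᵛ
    kills ℓ-prime (inj₁ (s≤s ℓ≤j)) = Separator.kills S ℓ-prime ℓ≤j
    kills ℓ-prime (inj₂ ≡.refl) m m*ℓ≡n = contradiction (ℓ-prime , divides m (≡.sym m*ℓ≡n)) ¬prime-divisor
  -- The prime `suc j` divides n = `radical` · `u`, while the primes in `radical` are at most j;
  -- hence it divides `u`.
  ... | S | yes (p-prime , ∣n) with euclidsLemma (Separator.radical S) (Separator.u S) p-prime
                                      (≡.subst (suc j ∣_) (≡.sym (Separator.factorisation S)) ∣n)
  ...   | inj₁ ∣R = contradiction (Separator.primes≤ S p-prime ∣R) ℕ.1+n≰n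
  ...   | inj₂ (divides u′ u≡u′p) = record
    { g = difference m₀ g ; radical = radical ℕ.* p ; u = u′
    ; factorisation = ≡.trans (≡.trans (ℕ.*-assoc radical p u′) (≡.cong (radical ℕ.*_) (≡.trans (ℕ.*-comm p u′) (≡.sym u≡u′p)))) factorisation
    ; nonzero = nonzero′
    ; supported = supported′
    ; primes≤ = primes≤′
    ; kills = λ ℓ-prime ℓ≤1+j → kills′ ℓ-prime (ℕ.m≤n⇒m<n∨m≡n ℓ≤1+j)
    }
    where
    open Separator S
    p = suc j
    -- This is n/p, so the new factor is X^(n/p) - 1.
    m₀ = radical ℕ.* u′
    m₀*p≡n : m₀ ℕ.* p ≡ n
    m₀*p≡n = ≡.trans (ℕ.*-assoc radical u′ p) (≡.trans (≡.cong (radical ℕ.*_) (≡.sym u≡u′p)) factorisation)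
    u∣n : u ∣ n
    u∣n = divides radical (≡.sym factorisation)
    u′∣u : u′ ∣ u
    u′∣u = divides p (≡.trans u≡u′p (ℕ.*-comm u′ p))
    u′≢0 : NonZero u′
    u′≢0 = ℕ.≢-nonZero λ u′≡0 → contradiction (≡.trans (≡.sym factorisation)
      (≡.trans (≡.cong (radical ℕ.*_) (≡.trans u≡u′p (≡.cong (ℕ._* p) u′≡0))) (ℕ.*-zeroʳ radical))) λ ()
    -- As u = p u′ and m₀ = `radical` · u′, divisibility would put the prime p into `radical`, whose
    -- primes are at most j.
    u∤m₀ : ¬ (u ∣ m₀)
    u∤m₀ u∣m₀ = ℕ.1+n≰n (primes≤ p-prime (*-cancelʳ-∣ u′ {{u′≢0}}
      (≡.subst (_∣ m₀) (≡.trans u≡u′p (ℕ.*-comm u′ p)) u∣m₀)))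
    nonzero′ : ∃ λ i → ¬ (difference m₀ g i ≈ 0#)
    nonzero′ with nonzero
    ... | i , gi≉0 = i , λ eq → gi≉0 (-‿≈0 (trans (sym (trans (+-congʳ translated≈0) (+-identityˡ _))) eq))
      where
      -‿≈0 : ∀ {a} → - a ≈ 0# → a ≈ 0#
      -‿≈0 -a≈0 = -‿injective (trans -a≈0 (sym -0#≈0#))
      -- If g were nonzero both at i and at i - m₀ mod n, then u would divide both positions. Since
      -- u also divides n, it would divide m₀.
      translated≈0 : σ^ m₀ g i ≈ 0#
      translated≈0 with σ^ m₀ g i ≟ 0#
      ... | yes p = p
      ... | no gσi≉0 with toℕ-prev^ m₀ i
      ...   | z , eq = contradiction
                (∣m+n∣n⇒∣m (≡.subst (u ∣_) (≡.sym eq) (∣m∣n⇒∣m+n (supported i gi≉0) (∣n⇒∣m*n z u∣n)))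
                  (supported _ (λ h → gσi≉0 (trans (reflexive (σ^-at m₀ g i)) h))))
                u∤m₀
    supported′ : ∀ i → ¬ (difference m₀ g i ≈ 0#) → u′ ∣ toℕ i
    supported′ i di≉0 with g i ≟ 0#
    ... | no gi≉0 = ∣-trans u′∣u (supported i gi≉0)
    ... | yes gi≈0 with toℕ-prev^ m₀ i
    ...   | z , eq = ∣m+n∣n⇒∣m (≡.subst (u′ ∣_) eq (∣m∣n⇒∣m+n (n∣m*n radical) (∣-trans u′∣u (supported _ gσi≉0))))
                       (∣n⇒∣m*n z (∣-trans u′∣u u∣n))
      where
      gσi≉0 : ¬ (g (prev^ m₀ i) ≈ 0#)
      gσi≉0 h = di≉0 (trans (+-cong (trans (reflexive (σ^-at m₀ g i)) h) (-‿cong gi≈0)) (-‿inverseʳ 0#))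
    primes≤′ : ∀ {ℓ} → Prime ℓ → ℓ ∣ radical ℕ.* p → ℓ ℕ.≤ suc j
    primes≤′ ℓ-prime ℓ∣ with euclidsLemma radical p ℓ-prime ℓ∣
    ... | inj₁ ℓ∣R = ℕ.m≤n⇒m≤1+n (primes≤ ℓ-prime ℓ∣R)
    ... | inj₂ ℓ∣p = ∣⇒≤ ℓ∣p
    kills′ : ∀ {ℓ} → Prime ℓ → ℓ ℕ.< suc j ⊎ ℓ ≡ suc j → ∀ m → m ℕ.* ℓ ≡ n → ∀ y → σ^ m y ≋ y → difference m₀ g ⊛ y ≋ 0ᵛ
    kills′ ℓ-prime (inj₁ (s≤s ℓ≤j)) m mℓ≡n y fixed =
      ≋-trans (difference-⊛ m₀ g y) (difference-zero m₀ (kills ℓ-prime ℓ≤j m mℓ≡n y fixed))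
    kills′ ℓ-prime (inj₂ ≡.refl) m mℓ≡n y fixed = difference-fixed m₀ g
      (≡.subst (λ k → σ^ k y ≋ y) (ℕ.*-cancelʳ-≡ m m₀ p (≡.trans mℓ≡n (≡.sym m₀*p≡n))) fixed)

  σ^-multiple : ∀ {d m} {y : Vect n} → σ^ d y ≋ y → d ∣ m → σ^ m y ≋ y
  σ^-multiple {d} fixed (divides zero    ≡.refl) = ≋-refl
  σ^-multiple {d} {y = y} fixed (divides (suc k) ≡.refl) =
    ≋-trans (σ^-+ d (k ℕ.* d) y) (≋-trans (IsLinear.cong (σ^-linear d) (σ^-multiple fixed (divides k ≡.refl))) fixed)

  σ^-difference : ∀ {d r s} {y : Vect n} → d ℕ.+ r ≡ s → σ^ r y ≋ y → σ^ s y ≋ y → σ^ d y ≋ y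
  σ^-difference {d} {r} {y = y} ≡.refl fixed-r fixed-s =
    ≋-trans (IsLinear.cong (σ^-linear d) (≋-sym fixed-r)) (≋-trans (≋-sym (σ^-+ d r y)) fixed-s)

  -- The exponents that fix y include all multiples of r and of n and are closed under differences;
  -- Bézout exhibits the gcd as such a difference.
  σ^-gcd : ∀ r {y : Vect n} → σ^ r y ≋ y → σ^ (gcd r n) y ≋ y
  σ^-gcd r {y} fixed with Bézout.identity (gcd-GCD r n)
  ... | Bézout.+- a b eq = σ^-difference {gcd r n} {b ℕ.* n} eq
          (σ^-multiple {n} (σ^n y) (n∣m*n b)) (σ^-multiple {r} fixed (n∣m*n a))
  ... | Bézout.-+ a b eq = σ^-difference {gcd r n} {a ℕ.* r} eq
          (σ^-multiple {r} fixed (n∣m*n a)) (σ^-multiple {n} (σ^n y) (n∣m*n b))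

  -- Stage n suffices, because every prime divisor of n is at most n.
  g : Vect n
  g = Separator.g (separator n)

  g≉0 : ¬ (g ≋ 0ᵛ)
  g≉0 g≋0 = let i , gi≉0 = Separator.nonzero (separator n) in gi≉0 (g≋0 i)

  -- With d = gcd(r,n) < n, choose a prime p dividing n/d. Then d divides n/p, so σ^(n/p) fixes y
  -- and the factor for p kills it.
  g-kills : ∀ r → 0 ℕ.< r → r ℕ.< n → ∀ y → σ^ r y ≋ y → g ⊛ y ≋ 0ᵛ
  g-kills r 0<r r<n y fixed with gcd[m,n]∣n r n
  ... | divides c n≡cd with primeDivisor c 1<c
    where
    d≤r : gcd r n ℕ.≤ r
    d≤r = ∣⇒≤ {{ℕ.>-nonZero 0<r}} (gcd[m,n]∣m r n)
    1<c : 1 ℕ.< c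
    1<c = ℕ.≰⇒> λ c≤1 → ℕ.<⇒≱ r<n (≡.subst (ℕ._≤ r) (≡.sym n≡cd)
      (ℕ.≤-trans (ℕ.*-monoˡ-≤ (gcd r n) c≤1) (≡.subst (ℕ._≤ r) (≡.sym (ℕ.*-identityˡ _)) d≤r)))
  ...   | p , p-prime , divides c′ c≡c′p = Separator.kills (separator n) p-prime
    (∣⇒≤ (divides (c′ ℕ.* gcd r n) (≡.sym m*p≡n))) (c′ ℕ.* gcd r n) m*p≡n y
    (σ^-multiple (σ^-gcd r fixed) (n∣m*n c′))
    where
    m*p≡n : c′ ℕ.* gcd r n ℕ.* p ≡ n
    m*p≡n = ≡.trans (ℕ.*-assoc c′ (gcd r n) p) (≡.trans (≡.cong (c′ ℕ.*_) (ℕ.*-comm (gcd r n) p))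
      (≡.trans (≡.sym (ℕ.*-assoc c′ p (gcd r n))) (≡.trans (≡.cong (ℕ._* gcd r n) (≡.sym c≡c′p)) (≡.sym n≡cd))))

-- Numerical inequalities for the dimension.

suc≤^ : ∀ {q} → 2 ℕ.≤ q → ∀ t → suc t ℕ.≤ q ℕ.^ t
suc≤^ 2≤q zero = s≤s z≤n
suc≤^ {q} 2≤q (suc t) = begin
  suc (suc t)       ≤⟨ s≤s (ℕ.m≤m+n (suc t) t) ⟩
  suc (suc t ℕ.+ t) ≡⟨ solve 1 (λ t → con 2 :+ (t :+ t) := con 2 :* (con 1 :+ t)) ≡.refl t ⟩
  2 ℕ.* suc t       ≤⟨ ℕ.*-mono-≤ 2≤q (suc≤^ 2≤q t) ⟩
  q ℕ.* q ℕ.^ t     ∎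
  where open ℕ.≤-Reasoning
        open +-*-Solver

-- Multiply `counted` by q^C and bound q^N by (nm + 1) q^(C-m). After cancelling q^m, the exponents
-- can be compared because q ≥ 2.
dimension-bound : ∀ {q} → 2 ℕ.≤ q → ∀ {n N C m r} → 1 ℕ.≤ m → m ℕ.≤ C → q ℕ.^ N ≡ suc (n ℕ.* C) →
                  q ℕ.^ r ℕ.* suc (n ℕ.* m) ℕ.≤ q ℕ.^ m ℕ.* q ℕ.^ n → r ℕ.+ N ℕ.≤ n ℕ.+ C
dimension-bound {q} 2≤q {n} {N} {C} {m} {r} 1≤m m≤C q^N≡ counted = ℕ.≮⇒≥ λ n+C<r+N →
  ℕ.<⇒≱ (ℕ.^-monoʳ-< q 2≤q n+C<r+N) (ℕ.*-cancelʳ-≤ (q ℕ.^ (r ℕ.+ N)) (q ℕ.^ (n ℕ.+ C)) (q ℕ.^ m) bound)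
  where
  open ℕ.≤-Reasoning
  open +-*-Solver
  t = C ℕ.∸ m
  C≡ : m ℕ.+ t ≡ C
  C≡ = ℕ.m+[n∸m]≡n m≤C
  instance
    q≢0 : NonZero q
    q≢0 = ℕ.>-nonZero (ℕ.<-trans (s≤s z≤n) 2≤q)
    q^m≢0 : NonZero (q ℕ.^ m)
    q^m≢0 = ℕ.m^n≢0 q m
  -- With C = m + t, the excess n t is at most (nm + 1) t because m ≥ 1, and 1 + t ≤ q^t.
  q^N≤ : q ℕ.^ N ℕ.≤ suc (n ℕ.* m) ℕ.* q ℕ.^ t
  q^N≤ = begin
    q ℕ.^ N                                           ≡⟨ q^N≡ ⟩
    suc (n ℕ.* C)                                     ≡⟨ ≡.cong (λ k → suc (n ℕ.* k)) C≡ ⟨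
    suc (n ℕ.* (m ℕ.+ t))                             ≡⟨ solve 3 (λ n m t → con 1 :+ n :* (m :+ t) := (con 1 :+ n :* m) :+ n :* con 1 :* t) ≡.refl n m t ⟩
    suc (n ℕ.* m) ℕ.+ n ℕ.* 1 ℕ.* t                   ≤⟨ ℕ.+-monoʳ-≤ (suc (n ℕ.* m)) (ℕ.*-monoˡ-≤ t (ℕ.≤-trans (ℕ.*-monoʳ-≤ n 1≤m) (ℕ.n≤1+n (n ℕ.* m)))) ⟩
    suc (n ℕ.* m) ℕ.+ suc (n ℕ.* m) ℕ.* t             ≡⟨ ℕ.*-suc (suc (n ℕ.* m)) t ⟨
    suc (n ℕ.* m) ℕ.* suc t                           ≤⟨ ℕ.*-monoʳ-≤ (suc (n ℕ.* m)) (suc≤^ 2≤q t) ⟩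
    suc (n ℕ.* m) ℕ.* q ℕ.^ t                         ∎
  bound : q ℕ.^ (r ℕ.+ N) ℕ.* q ℕ.^ m ℕ.≤ q ℕ.^ (n ℕ.+ C) ℕ.* q ℕ.^ m
  bound = begin
    q ℕ.^ (r ℕ.+ N) ℕ.* q ℕ.^ m                             ≡⟨ ≡.cong (ℕ._* q ℕ.^ m) (ℕ.^-distribˡ-+-* q r N) ⟩
    q ℕ.^ r ℕ.* q ℕ.^ N ℕ.* q ℕ.^ m                         ≤⟨ ℕ.*-monoˡ-≤ (q ℕ.^ m) (ℕ.*-monoʳ-≤ (q ℕ.^ r) q^N≤) ⟩
    q ℕ.^ r ℕ.* (suc (n ℕ.* m) ℕ.* q ℕ.^ t) ℕ.* q ℕ.^ m     ≡⟨ solve 4 (λ a b c d → a :* (b :* c) :* d := (a :* b) :* (d :* c)) ≡.refl (q ℕ.^ r) (suc (n ℕ.* m)) (q ℕ.^ t) (q ℕ.^ m) ⟩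
    q ℕ.^ r ℕ.* suc (n ℕ.* m) ℕ.* (q ℕ.^ m ℕ.* q ℕ.^ t)     ≡⟨ ≡.cong (q ℕ.^ r ℕ.* suc (n ℕ.* m) ℕ.*_) (≡.trans (≡.sym (ℕ.^-distribˡ-+-* q m t)) (≡.cong (q ℕ.^_) C≡)) ⟩
    q ℕ.^ r ℕ.* suc (n ℕ.* m) ℕ.* q ℕ.^ C                   ≤⟨ ℕ.*-monoˡ-≤ (q ℕ.^ C) counted ⟩
    q ℕ.^ m ℕ.* q ℕ.^ n ℕ.* q ℕ.^ C                         ≡⟨ solve 3 (λ a b c → a :* b :* c := b :* c :* a) ≡.refl (q ℕ.^ m) (q ℕ.^ n) (q ℕ.^ C) ⟩
    q ℕ.^ n ℕ.* q ℕ.^ C ℕ.* q ℕ.^ m                         ≡⟨ ≡.cong (ℕ._* q ℕ.^ m) (ℕ.^-distribˡ-+-* q n C) ⟨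
    q ℕ.^ (n ℕ.+ C) ℕ.* q ℕ.^ m                             ∎

-- Truncation is harmless: for N ≤ C the left side is 0, and otherwise C can be cancelled.
∸-transfer : ∀ {r N n C} → r ℕ.+ N ℕ.≤ n ℕ.+ C → N ℕ.∸ C ℕ.≤ n ℕ.∸ r
∸-transfer {r} {N} {n} {C} r+N≤n+C with ℕ.≤-total N C
... | inj₁ N≤C = ≡.subst (ℕ._≤ n ℕ.∸ r) (≡.sym (ℕ.m≤n⇒m∸n≡0 N≤C)) z≤n
... | inj₂ C≤N = ℕ.m+n≤o⇒m≤o∸n (N ℕ.∸ C) (ℕ.+-cancelʳ-≤ C _ _ (begin
  (N ℕ.∸ C ℕ.+ r) ℕ.+ C   ≡⟨ solve 3 (λ a b c → a :+ b :+ c := b :+ (a :+ c)) ≡.refl (N ℕ.∸ C) r C ⟩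
  r ℕ.+ (N ℕ.∸ C ℕ.+ C)   ≡⟨ ≡.cong (r ℕ.+_) (ℕ.m∸n+n≡m C≤N) ⟩
  r ℕ.+ N                 ≤⟨ r+N≤n+C ⟩
  n ℕ.+ C                 ∎))
  where open ℕ.≤-Reasoning
        open +-*-Solver

primePower≥2 : ∀ {q} → IsPrimePower q → 2 ℕ.≤ q
primePower≥2 (p , suc e , p-prime , _ , ≡.refl) =
  ℕ.*-mono-≤ 2≤p (ℕ.m^n>0 p {{ℕ.>-nonZero (ℕ.<-trans (s≤s z≤n) 2≤p)}} e)
  where
  2≤p = ℕ.nonTrivial⇒n>1 p {{prime⇒nonTrivial p-prime}}

-- The subspace U = W + (1 - f)A, its covering property and its size.

lookup-injective : ∀ {a ℓ} {A : Set a} {_~_ : A → A → Set ℓ} → (∀ {x y} → x ~ y → y ~ x) → ∀ {xs} →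
                   AllPairs (λ x y → ¬ (x ~ y)) xs → ∀ i j → lookup xs i ~ lookup xs j → i ≡ j
lookup-injective sym {x ∷ xs} (x≁ ∷ distinct) zero    zero    eq = ≡.refl
lookup-injective sym {x ∷ xs} (x≁ ∷ distinct) zero    (suc j) eq = contradiction eq (All.lookup x≁ (∈-lookup j))
lookup-injective sym {x ∷ xs} (x≁ ∷ distinct) (suc i) zero    eq = contradiction (sym eq) (All.lookup x≁ (∈-lookup i))
lookup-injective sym {x ∷ xs} (x≁ ∷ distinct) (suc i) (suc j) eq = ≡.cong suc (lookup-injective sym distinct i j eq)

module Construction {q : ℕ} (F : FiniteField q) (n-1 bound : ℕ)
  (decomposition : OrbitDecomposition (ShiftRing.shiftRing F n-1) (ShiftRing.shift F n-1) (suc n-1) bound) where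
  open FiniteField F hiding (zero)
  open LinAlg F renaming (_≋_ to infix 4 _≋_; _+ᵛ_ to infixl 6 _+ᵛ_; _·ᵛ_ to infix 8 _·ᵛ_)
  open FieldProperties F
  open LinearAlgebra F
  open ShiftRing F n-1
  open OrbitDecomposition decomposition
  private n = suc n-1
  private module A = CommutativeRing shiftRing
  open import Algebra.Properties.CommutativeSemiring.Exp A.commutativeSemiring using (_^_)
  open import Algebra.Properties.Ring A.ring using (x[y-z]≈xy-xz; //-rightDividesˡ; +-cancelʳ)
  open import Relation.Binary.Reasoning.Setoid A.setoid

  m : ℕ
  m = length representatives

  complement : Vect n → Vect n
  complement x = x A.- f ⊛ x

  f-complement : ∀ x → f ⊛ complement x ≋ 0ᵛ
  f-complement x = begin
    f ⊛ complement x              ≈⟨ x[y-z]≈xy-xz f x (f ⊛ x) ⟩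
    f ⊛ x A.- f ⊛ (f ⊛ x)         ≈⟨ A.+-congˡ (A.-‿cong (≋-trans (≋-sym (⊛-assoc f f x)) (IsLinear.cong (⊛-linearˡ x) f-idem))) ⟩
    f ⊛ x A.- f ⊛ x               ≈⟨ A.-‿inverseʳ (f ⊛ x) ⟩
    0ᵛ                            ∎

  complement-cong : ∀ {x y} → x ≋ y → complement x ≋ complement y
  complement-cong x≋y = A.+-cong x≋y (A.-‿cong (IsLinear.cong (⊛-linearʳ f) x≋y))

  -- Complements of all vectors exhaust (1 - f)A, so the span is W + (1 - f)A and a basis is
  -- extracted from one finite list.
  generators : List (Vect n)
  generators = representatives ++ map complement vectors

  private
    extracted : ∃ λ r → Σ (Fin r → Vect n) λ b → LinIndep b × All (Span b) generators × (∀ j → b j ∈ generators)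
    extracted = basis-of-list generators

  dimension : ℕ
  dimension = proj₁ extracted

  basis : Fin dimension → Vect n
  basis = proj₁ (proj₂ extracted)

  basis-independent : LinIndep basis
  basis-independent = proj₁ (proj₂ (proj₂ extracted))

  generators-spanned : All (Span basis) generators
  generators-spanned = proj₁ (proj₂ (proj₂ (proj₂ extracted)))

  basis-from-generators : ∀ j → basis j ∈ generators
  basis-from-generators = proj₂ (proj₂ (proj₂ (proj₂ extracted)))

  U-isSubspace : IsSubspace (Span basis)
  U-isSubspace = Span-isSubspace basis
  open IsSubspace U-isSubspace using (resp; close+)

  representative∈U : ∀ {w} → w ∈ representatives → Span basis w
  representative∈U w∈ = All.lookup generators-spanned (Any.++⁺ˡ w∈)

  complement∈U : ∀ x → Span basis (complement x)
  complement∈U x with find (vectors-complete x)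
  ... | a , a∈ , x≋a = resp (complement-cong (≋-sym x≋a))
          (All.lookup generators-spanned (Any.++⁺ʳ representatives (Any.map⁺ (Any.map (≡.cong complement) a∈))))

  -- Split x = fx + (1 - f)x. If fx = X^r w, then x = X^r (w + (1 - f) X^(-r) x), because (1 - f)A
  -- is an ideal and hence stable under X. If fx = 0, then x already lies in U.
  covering : CyclicallyCovering (Span basis)
  covering x with covers x
  ... | inj₁ fx≋0 = zero , x , resp complement≋ (complement∈U x) , ≋-refl
    where
    complement≋ : complement x ≋ x
    complement≋ = begin
      x A.- f ⊛ x     ≈⟨ A.+-congˡ (A.-‿cong fx≋0) ⟩
      x A.- 0ᵛ        ≈⟨ A.+-identityʳ _ ⟨
      x A.- 0ᵛ +ᵛ 0ᵛ  ≈⟨ //-rightDividesˡ 0ᵛ x ⟩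
      x               ∎
  ... | inj₂ fx∈ with source _ fx∈
  ...   | r , w , r<n , w∈ , eq = fromℕ< r<n , w +ᵛ complement y ,
          close+ (representative∈U w∈) (complement∈U y) ,
          ≡.subst (λ k → σ^ k (w +ᵛ complement y) ≋ x) (≡.sym (Fin.toℕ-fromℕ< r<n)) rotated
    where
    -- The vector X^(-r) x, as X^n = 1.
    y = σ^ (n ℕ.∸ r) x
    σ^y : σ^ r y ≋ x
    σ^y = ≋-trans (≋-sym (σ^-+ r (n ℕ.∸ r) x))
            (≡.subst (λ k → σ^ k x ≋ x) (≡.sym (ℕ.m+[n∸m]≡n (ℕ.<⇒≤ r<n))) (σ^n x))
    rotated : σ^ r (w +ᵛ complement y) ≋ x
    rotated = begin
      σ^ r (w +ᵛ complement y)                        ≈⟨ shift^-⊛ r _ ⟨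
      (shift ^ r) ⊛ (w +ᵛ complement y)               ≈⟨ IsLinear.+-hom (⊛-linearʳ (shift ^ r)) w (complement y) ⟩
      (shift ^ r) ⊛ w +ᵛ (shift ^ r) ⊛ complement y   ≈⟨ A.+-cong eq (x[y-z]≈xy-xz (shift ^ r) y (f ⊛ y)) ⟩
      f ⊛ x +ᵛ ((shift ^ r) ⊛ y A.- (shift ^ r) ⊛ (f ⊛ y))
        ≈⟨ A.+-congˡ (A.+-cong (≋-trans (shift^-⊛ r y) σ^y) (A.-‿cong (≋-trans (shift^-⊛ r (f ⊛ y))
             (≋-trans (≋-sym (σ^-commute (⊛-linearʳ f) (⊛-σʳ f) r y)) (IsLinear.cong (⊛-linearʳ f) σ^y))))) ⟩
      f ⊛ x +ᵛ (x A.- f ⊛ x)                          ≈⟨ A.+-comm _ _ ⟩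
      (x A.- f ⊛ x) +ᵛ f ⊛ x                          ≈⟨ //-rightDividesˡ (f ⊛ x) x ⟩
      x                                               ∎

  -- f fixes the representatives and annihilates the complements, so it maps U into W. Thus fu is
  -- described by m coefficients, even if the representatives are dependent.
  f-basis : ∀ j → Span (lookup representatives) (f ⊛ basis j)
  f-basis j = All.lookup f-generators (basis-from-generators j)
    where
    module W = IsSubspace (Span-isSubspace (lookup representatives))
    f-generators : All (λ x → Span (lookup representatives) (f ⊛ x)) generators
    f-generators = All.++⁺
      (All.tabulate (λ {w} w∈ → W.resp (≋-sym (All.lookup fixed w∈))
        (≡.subst (Span (lookup representatives)) (≡.sym (Any.lookup-index w∈)) (Span-generator (lookup representatives) (Any.index w∈)))))
      (All.map⁺ (All.tabulate (λ {x} _ → W.resp (≋-sym (f-complement x)) W.has0)))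

  f-lincomb : ∀ a → Span (lookup representatives) (f ⊛ lincomb a basis)
  f-lincomb a = IsSubspace.resp W (≋-sym (IsLinear.lincomb-hom (⊛-linearʳ f) a basis)) (lincomb-closed W a f-basis)
    where W = Span-isSubspace (lookup representatives)

  fieldPoints : List (Vect n)
  fieldPoints = 0ᵛ ∷ points

  fieldPoints-fixed : All (λ y → f ⊛ y ≋ y) fieldPoints
  fieldPoints-fixed = IsLinear.0-hom (⊛-linearʳ f) ∷ All.map proj₁ units

  fieldPoints-distinct : AllPairs (λ y z → ¬ (y ≋ z)) fieldPoints
  fieldPoints-distinct = All.map (λ (_ , y≉0) 0≋y → y≉0 (≋-sym 0≋y)) units ∷ distinct

  -- (u, y) ↦ (coordinates of f u, (1 - f) u + y) is injective on U × fA.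
  encode : Fin (q ℕ.^ dimension) → Fin (length fieldPoints) → Fin (q ℕ.^ m ℕ.* q ℕ.^ n)
  encode i v = combine (vectorIndex (proj₁ (f-lincomb (vector i))))
                       (vectorIndex (complement (lincomb (vector i) basis) +ᵛ lookup fieldPoints v))

  -- Applying f to (1 - f)u + y leaves y. Subtracting y gives (1 - f)u, the first component gives
  -- fu, and their sum is u.
  encode-injective : ∀ i v i′ v′ → encode i v ≡ encode i′ v′ → i ≡ i′ × v ≡ v′
  encode-injective i v i′ v′ eq = vector-injective (LinIndep-injective basis basis-independent _ _ u≋u′) ,
    lookup-injective ≋-sym fieldPoints-distinct v v′ y≋y′
    where
    u  = lincomb (vector i) basis
    u′ = lincomb (vector i′) basis
    y  = lookup fieldPoints v
    y′ = lookup fieldPoints v′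
    indices = Fin.combine-injective (vectorIndex (proj₁ (f-lincomb (vector i)))) _ (vectorIndex (proj₁ (f-lincomb (vector i′)))) _ eq
    fu≋fu′ : f ⊛ u ≋ f ⊛ u′
    fu≋fu′ = ≋-trans (≋-sym (proj₂ (f-lincomb (vector i)))) (≋-trans
      (IsLinear.cong (lincomb-linearˡ (lookup representatives)) (vectorIndex-injective (proj₁ indices)))
      (proj₂ (f-lincomb (vector i′))))
    sums≋ : complement u +ᵛ y ≋ complement u′ +ᵛ y′
    sums≋ = vectorIndex-injective (proj₂ indices)
    project : ∀ x k → f ⊛ (complement x +ᵛ lookup fieldPoints k) ≋ lookup fieldPoints k
    project x k = begin
      f ⊛ (complement x +ᵛ lookup fieldPoints k)       ≈⟨ IsLinear.+-hom (⊛-linearʳ f) (complement x) (lookup fieldPoints k) ⟩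
      f ⊛ complement x +ᵛ f ⊛ lookup fieldPoints k     ≈⟨ A.+-cong (f-complement x) (All.lookup fieldPoints-fixed (∈-lookup k)) ⟩
      0ᵛ +ᵛ lookup fieldPoints k                       ≈⟨ A.+-identityˡ _ ⟩
      lookup fieldPoints k                             ∎
    y≋y′ : y ≋ y′
    y≋y′ = ≋-trans (≋-sym (project u v)) (≋-trans (IsLinear.cong (⊛-linearʳ f) sums≋) (project u′ v′))
    u≋u′ : u ≋ u′
    u≋u′ = begin
      u                               ≈⟨ //-rightDividesˡ (f ⊛ u) u ⟨
      complement u +ᵛ f ⊛ u           ≈⟨ A.+-cong (+-cancelʳ y (complement u) (complement u′) (≋-trans sums≋ (A.+-congˡ (≋-sym y≋y′)))) fu≋fu′ ⟩
      complement u′ +ᵛ f ⊛ u′         ≈⟨ //-rightDividesˡ (f ⊛ u′) u′ ⟩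
      u′                              ∎

  counted : q ℕ.^ dimension ℕ.* suc (n ℕ.* m) ℕ.≤ q ℕ.^ m ℕ.* q ℕ.^ n
  counted = ≡.subst (λ k → q ℕ.^ dimension ℕ.* suc k ℕ.≤ q ℕ.^ m ℕ.* q ℕ.^ n) count
    (Fin.injective⇒≤ {f = λ k → let i , v = remQuot (length fieldPoints) k in encode i v} λ {k} {k′} eq →
      let i≡i′ , v≡v′ = encode-injective _ _ _ _ eq in
      ≡.trans (≡.sym (Fin.combine-remQuot {q ℕ.^ dimension} (length fieldPoints) k))
        (≡.trans (≡.cong₂ combine i≡i′ v≡v′) (Fin.combine-remQuot {q ℕ.^ dimension} (length fieldPoints) k′)))

-- Assembly, and the identity Q = nC + 1.

module _ {q : ℕ} (F : FiniteField q) (q-primePower : IsPrimePower q) (n-1 N C t : ℕ)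
  (q^N≡ : q ℕ.^ N ≡ suc (suc n-1 ℕ.* C)) (t≡ : suc n-1 ℕ.* C ≡ suc t) where
  open LinearAlgebra F
  open ShiftRing F n-1
  open Separation F n-1
  open import Algebra.Properties.Semiring.Exp (CommutativeRing.semiring shiftRing) using (_^_)

  shiftRing-orbits : OrbitDecomposition shiftRing shift (suc n-1) (suc t)
  shiftRing-orbits = FreeOrbits.orbitDecomposition shiftRing _≋?_ vectors vectors-complete t
    (λ a → ≋-trans (CommutativeRing.reflexive shiftRing (≡.cong (a ^_) (≡.sym (≡.trans q^N≡ (≡.cong suc t≡))))) (power-Q q-primePower N C q^N≡ a))
    shift (suc n-1) (s≤s z≤n) shift^n g g≉0
    (λ r 0<r r<n y fixed → g-kills r 0<r r<n y (≋-trans (≋-sym (shift^-⊛ r y)) fixed))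

  covering-subspace : LinAlg.hAtLeast F (suc n-1) (N ℕ.∸ C)
  covering-subspace = Span basis , U-isSubspace , covering , dimension ,
    (basis , basis-independent , Span-generator basis , λ x x∈ → x∈) ,
    ∸-transfer {dimension} (dimension-bound (primePower≥2 q-primePower) {N = N} {r = dimension} nonempty m≤C q^N≡ counted)
    where
    open OrbitDecomposition shiftRing-orbits
    open Construction F n-1 (suc t) shiftRing-orbits
    -- The n·m points are units of fA, at most Q - 1 = n·C in number; cancel n.
    m≤C : m ℕ.≤ C
    m≤C = ℕ.*-cancelˡ-≤ (suc n-1) (≡.subst₂ ℕ._≤_ count (≡.sym t≡) bounded)

geom-closed : ∀ q-1 k → suc (q-1 ℕ.* geom (suc q-1) k) ≡ suc q-1 ℕ.^ k
geom-closed q-1 zero    = ≡.cong suc (ℕ.*-zeroʳ q-1)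
geom-closed q-1 (suc k) = ≡.trans (≡.cong suc (ℕ.*-distribˡ-+ q-1 (geom (suc q-1) k) (suc q-1 ℕ.^ k)))
  (≡.cong (ℕ._+ q-1 ℕ.* suc q-1 ℕ.^ k) (geom-closed q-1 k))

-- The geometric series of ratio q^k, with y = q^k - 1 introduced through `suc` to avoid
-- subtraction.
powSum-closed : ∀ {q y} k d → suc y ≡ q ℕ.^ k → suc (y ℕ.* powSum q k d) ≡ q ℕ.^ (k ℕ.* d ℕ.+ k)
powSum-closed {q} {y} k zero y≡ = ≡.trans (≡.cong suc (ℕ.*-identityʳ y))
  (≡.trans y≡ (≡.cong (λ j → q ℕ.^ (j ℕ.+ k)) (≡.sym (ℕ.*-zeroʳ k))))
powSum-closed {q} {y} k (suc d) y≡ = begin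
  suc (y ℕ.* (powSum q k d ℕ.+ q ℕ.^ (k ℕ.* suc d)))            ≡⟨ ≡.cong suc (ℕ.*-distribˡ-+ y (powSum q k d) _) ⟩
  suc (y ℕ.* powSum q k d) ℕ.+ y ℕ.* q ℕ.^ (k ℕ.* suc d)        ≡⟨ ≡.cong (ℕ._+ y ℕ.* q ℕ.^ (k ℕ.* suc d)) (powSum-closed k d y≡) ⟩
  q ℕ.^ (k ℕ.* d ℕ.+ k) ℕ.+ y ℕ.* q ℕ.^ (k ℕ.* suc d)           ≡⟨ ≡.cong (λ j → q ℕ.^ j ℕ.+ y ℕ.* q ℕ.^ (k ℕ.* suc d)) (≡.trans (ℕ.+-comm (k ℕ.* d) k) (≡.sym (ℕ.*-suc k d))) ⟩
  suc y ℕ.* q ℕ.^ (k ℕ.* suc d)                                 ≡⟨ ≡.cong (ℕ._* q ℕ.^ (k ℕ.* suc d)) y≡ ⟩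
  q ℕ.^ k ℕ.* q ℕ.^ (k ℕ.* suc d)                               ≡⟨ ℕ.^-distribˡ-+-* q k (k ℕ.* suc d) ⟨
  q ℕ.^ (k ℕ.+ k ℕ.* suc d)                                     ≡⟨ ≡.cong (q ℕ.^_) (ℕ.+-comm k (k ℕ.* suc d)) ⟩
  q ℕ.^ (k ℕ.* suc d ℕ.+ k)                                     ∎
  where open ≡.≡-Reasoning

-- Both geometric series combine: n c (q^k - 1)/(q - 1) = (q^k - 1) Σ q^(kr) = q^(kd+k) - 1.
index-closed : ∀ q-1 k d n c → n ℕ.* c ≡ M (suc q-1) k d →
               suc q-1 ℕ.^ (k ℕ.* d ℕ.+ k) ≡ suc (n ℕ.* (c ℕ.* geom (suc q-1) k))
index-closed q-1 k d n c nc≡M = ≡.trans (≡.sym (powSum-closed k d (geom-closed q-1 k))) (≡.cong suc (begin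
  q-1 ℕ.* G ℕ.* P       ≡⟨ solve 3 (λ a b c → a :* b :* c := (a :* c) :* b) ≡.refl q-1 G P ⟩
  q-1 ℕ.* P ℕ.* G       ≡⟨ ≡.cong (ℕ._* G) nc≡M ⟨
  n ℕ.* c ℕ.* G         ≡⟨ ℕ.*-assoc n c G ⟩
  n ℕ.* (c ℕ.* G)       ∎))
  where
  open ≡.≡-Reasoning
  open +-*-Solver
  G = geom (suc q-1) k
  P = powSum (suc q-1) k d

open import Data.Nat using (ℕ; _+_; _*_; _∸_; _^_; _≤_; _<_)
open import Relation.Binary.PropositionalEquality using (_≡_)

theorem3p3 : (q k d c n : ℕ) → IsPrimePower q → 1 ≤ k →
    n * c ≡ M q k d →
    c * (q ^ k ∸ 1) * q ^ (k * d) < (q ∸ 1) * (q ^ (k * d + k) ∸ 1) →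
    (F : FiniteField q) →
    LinAlg.hAtLeast F n (k * d + k ∸ c * geom q k)
theorem3p3 zero k d c n q-primePower 1≤k nc≡M _ F = contradiction (primePower≥2 q-primePower) λ ()
theorem3p3 q@(suc q-1) k d c n q-primePower 1≤k nc≡M _ F = build n (index-closed q-1 k d n c nc≡M)
  where
  N = k * d + k
  C = c * geom q k
  1<q^N : 1 < q ^ N
  1<q^N = ℕ.^-monoʳ-< q (primePower≥2 q-primePower) {0} {N} (ℕ.≤-trans 1≤k (ℕ.m≤n+m k (k * d)))
  build : ∀ n → q ^ N ≡ suc (n * C) → LinAlg.hAtLeast F n (N ∸ C)
  -- A vanishing product nC, in particular n = 0, would make q^N equal to 1, whereas k ≥ 1 gives N ≥
  -- 1.
  build zero q^N≡ = contradiction q^N≡ (ℕ.>⇒≢ 1<q^N)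
  build (suc n-1) q^N≡ with suc n-1 * C in t≡
  ... | zero  = contradiction q^N≡ (ℕ.>⇒≢ 1<q^N)
  ... | suc t = covering-subspace F q-primePower n-1 N C t (≡.trans q^N≡ (≡.cong suc (≡.sym t≡))) t≡
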